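{- Let $\mathcal{S}$ be a finite set of logical relations. If $\mathcal{S}$ is not tight, then every logical relation is faithfully expressible from $\mathcal{S}$.
   Context: A logical relation is a non-empty subset $R\subseteq\{0,1\}^k$ for some $k\ge 1$ ($k$ is its arity). For a finite set $\mathcal{S}$ of logical relations, a CNF$(\mathcal{S})$-formula over variables $x_1,\dots,x_n$ is a finite conjunction of clauses $R(\xi_1,\dots,\xi_k)$ with $R\in\mathcal{S}$ of arity $k$ and each $\xi_j$ a variable or one of the constants $0,1$; a solution is an assignment satisfying every clause. For a formula (or relation) $\varphi$, $G(\varphi)$ is the subgraph of the hypercube induced by its solutions: vertices are the solutions, and two are adjacent iff they differ in exactly one coordinate. A relation is bijunctive if it is the set of solutions of a 2-CNF formula. A relation $R\subseteq\{0,1\}^k$ is componentwise bijunctive if every connected component of $G(R)$ (viewed as a subset of $\{0,1\}^k$) is bijunctive. $R$ is OR-free if the relation $\{01,10,11\}$ cannot be obtained from $R$ by fixing $k-2$ of its coordinates to constants; $R$ is NAND-free if $\{00,01,10\}$ cannot be obtained from $R$ by fixing $k-2$ of its coordinates to constants. A set $\mathcal{S}$ is tight if every relation in $\mathcal{S}$ is componentwise bijunctive, or every relation in $\mathcal{S}$ is OR-free, or every relation in $\mathcal{S}$ is NAND-free. A relation $R$ is faithfully expressible from $\mathcal{S}$ if there is a CNF$(\mathcal{S})$-formula $\varphi(\mathbf{x},\mathbf{y})$ such that: (1) $R=\{\mathbf{a}:\exists\mathbf{y}\,\varphi(\mathbf{a},\mathbf{y})\}$; (2) for every $\mathbf{a}\in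 R$ the graph $G(\varphi(\mathbf{a},\mathbf{y}))$ (the solutions in $\mathbf{y}$ with $\mathbf{x}=\mathbf{a}$ fixed) is connected; (3) for all $\mathbf{a},\mathbf{b}\in R$ at Hamming distance $1$ there is $\mathbf{w}$ with both $(\mathbf{a},\mathbf{w})$ and $(\mathbf{b},\mathbf{w})$ solutions of $\varphi$. -}

module Defs where

open import Data.Bool using (Bool; true; false; not; _∨_; _∧_)
open import Data.Nat using (ℕ; _+_; _≤_)
open import Data.Fin using (Fin)
open import Data.Vec using (Vec; lookup; _[_]≔_; _++_)
open import Data.List using (List; length)
import Data.List as L
open import Data.List.Relation.Unary.All using (All)
open import Data.List.Relation.Unary.Any using (Any)
open import Data.Product using (Σ; ∃; ∃-syntax; _×_; _,_)
open import Data.Sum using (_⊎_)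
open import Relation.Nullary using (¬_)
open import Relation.Binary.PropositionalEquality using (_≡_; _≢_)

BoolPred : ℕ → Set₁
BoolPred k = Vec Bool k → Set

Adjacent : {k : ℕ} → Vec Bool k → Vec Bool k → Set
Adjacent {k} u v = Σ (Fin k) λ i → v ≡ u [ i ]≔ not (lookup u i)

data Path {k : ℕ} (P : BoolPred k) : Vec Bool k → Vec Bool k → Set where
  here : ∀ {u} → P u → Path P u u
  step : ∀ {u v w} → P u → Adjacent u v → Path P v w → Path P u w

Connected : {k : ℕ} → BoolPred k → Set
Connected P = ∀ u v → P u → P v → Path P u v

record LogicalRelation : Set where
  field
    arity    : ℕ
    rel      : Vec Bool arity → Bool
    nonempty : ∃[ v ] rel v ≡ true

open LogicalRelation public

_∈R_ : {k : ℕ} → Vec Bool k → (Vec Bool k → Bool) → Set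
v ∈R R = R v ≡ true

Literal : ℕ → Set
Literal k = Fin k × Bool

evalLit : {k : ℕ} → Vec Bool k → Literal k → Bool
evalLit v (i , true)  = lookup v i
evalLit v (i , false) = not (lookup v i)

Clause2 : ℕ → Set
Clause2 k = Σ (List (Literal k)) λ ls → length ls ≤ 2

sat2Clause : {k : ℕ} → Vec Bool k → Clause2 k → Set
sat2Clause v (ls , _) = Any (λ l → evalLit v l ≡ true) ls

TwoCNF : ℕ → Set
TwoCNF k = List (Clause2 k)

sat2CNF : {k : ℕ} → TwoCNF k → Vec Bool k → Set
sat2CNF φ v = All (sat2Clause v) φ

Bijunctive : {k : ℕ} → BoolPred k → Set
Bijunctive {k} P = Σ (TwoCNF k) λ φ → ∀ v → (P v → sat2CNF φ v) × (sat2CNF φ v → P v)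

ComponentwiseBijunctive : LogicalRelation → Set
ComponentwiseBijunctive R =
  ∀ v → v ∈R rel R → Bijunctive (λ u → Path (λ w → w ∈R rel R) v u)

-- fixing all coordinates except two distinct ones i, j (to the values in c)
-- and reading the remaining coordinates as (x_i , x_j)
restrict2 : {k : ℕ} → Vec Bool k → Fin k → Fin k → Bool → Bool → Vec Bool k
restrict2 c i j a b = (c [ i ]≔ a) [ j ]≔ b

Obtains : LogicalRelation → (Bool → Bool → Bool) → Set
Obtains R g = Σ (Fin (arity R)) λ i → Σ (Fin (arity R)) λ j → i ≢ j ×
  Σ (Vec Bool (arity R)) λ c → ∀ a b → rel R (restrict2 c i j a b) ≡ g a b

ORFree : LogicalRelation → Set
ORFree R = ¬ Obtains R _∨_

NANDFree : LogicalRelation → Set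
NANDFree R = ¬ Obtains R (λ a b → not (a ∧ b))

Tight : List LogicalRelation → Set
Tight S = All ComponentwiseBijunctive S ⊎ All ORFree S ⊎ All NANDFree S

data Term (n : ℕ) : Set where
  var   : Fin n → Term n
  const : Bool → Term n

evalTerm : {n : ℕ} → Vec Bool n → Term n → Bool
evalTerm v (var i)   = lookup v i
evalTerm v (const b) = b

evalArgs : {n k : ℕ} → Vec Bool n → Vec (Term n) k → Vec Bool k
evalArgs v ts = Data.Vec.map (evalTerm v) ts

record SClause (S : List LogicalRelation) (n : ℕ) : Set where
  field
    idx  : Fin (length S)
    args : Vec (Term n) (arity (L.lookup S idx))

CNF : List LogicalRelation → ℕ → Set
CNF S n = List (SClause S n)

satClause : {S : List LogicalRelation} {n : ℕ} → Vec Bool n → SClause S n → Set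
satClause {S} v c = rel (L.lookup S (SClause.idx c)) (evalArgs v (SClause.args c)) ≡ true

Sat : {S : List LogicalRelation} {n : ℕ} → CNF S n → Vec Bool n → Set
Sat φ v = All (satClause v) φ

-- Faithful expressibility (variables of φ are x₁..x_k followed by y₁..y_m)

FaithfullyExpressible : List LogicalRelation → LogicalRelation → Set
FaithfullyExpressible S R =
  Σ ℕ λ m → Σ (CNF S (arity R + m)) λ φ →
      (∀ a → (a ∈R rel R → ∃[ w ] Sat φ (a ++ w))
           × (∃[ w ] Sat φ (a ++ w) → a ∈R rel R))
    × (∀ a → a ∈R rel R → Connected (λ w → Sat φ (a ++ w)))
    × (∀ a b → a ∈R rel R → b ∈R rel R → Adjacent a b →
         ∃[ w ] (Sat φ (a ++ w) × Sat φ (b ++ w)))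

{-# OPTIONS --safe #-}
module Submission where

-- Faithful expressibility is preserved by conjunction, by substitution of terms in which no variable
-- repeats, and by faithful existential quantification. As S is not tight, constants turn some relation
-- into x ∨ y and another into ¬ (x ∧ y), and x → y is ∃ z. ¬ (x ∧ z) ∧ (z ∨ y). All clauses, hence all
-- relations, follow once the clauses with three literals are available.
--
-- Let P be a relation with a component that is not bijunctive, so not closed under majority.
-- If every path in P, and in every restriction of P by a 2-clause, could be shortened to a geodesic,
-- then the components would be closed under majority, by induction on the set of coordinates where
-- the three points are not all equal. So some path cannot be shortened, and a shortest witness is a
-- detour: flip a coordinate t, flip the coordinates of a list one after the other, flip t back, where
-- no intermediate point is a solution with t flipped back. Fixing the remaining coordinates and adding
-- 2-clauses leaves exactly this path, and projecting out all but two coordinates of the list leaves a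
-- path of length 4 between points at Hamming distance 2. Two such paths, combined into a cycle,
-- express a clause with three literals.

open import Defs
open import Data.Bool using (Bool; true; false; not; _∨_; _∧_; _xor_; if_then_else_)
import Data.Bool.Properties as Bool
open import Data.Fin using (Fin; zero; suc; _↑ˡ_; _↑ʳ_; splitAt)
open import Data.Fin.Patterns using (0F; 1F; 2F; 3F; 4F; 5F; 6F; 7F; 8F)
import Data.Fin.Properties as Fin
open import Data.Fin.Subset using (Subset; _⊂_)
import Data.Fin.Subset as Subset
open import Data.Fin.Subset.Induction using (Acc; acc; ⊂-wellFounded)
open import Data.Fin.Subset.Properties using (anySubset?)
open import Data.List using (List; []; _∷_; length)
import Data.List as L
open import Data.List.Membership.Propositional using (_∈_)
open import Data.List.Membership.Propositional.Properties
  using (∈-allFin; ∈-cartesianProduct⁺; ∈-filter⁺; ∈-map⁺)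
open import Data.List.Relation.Unary.All as All using (All; []; _∷_)
import Data.List.Relation.Unary.All.Properties as All
open import Data.List.Relation.Unary.AllPairs using ([]; _∷_)
open import Data.List.Relation.Unary.Any as Any using (here; there)
open import Data.List.Relation.Unary.Unique.Propositional using (Unique)
open import Data.Nat using (ℕ; zero; suc; _+_; _≤_; s≤s; z≤n)
open import Data.Nat.Properties using (≤-refl)
open import Data.Product using (Σ; ∃-syntax; _×_; _,_; proj₁; proj₂; map₂)
open import Data.Sum using (_⊎_; inj₁; inj₂; [_,_]′)
open import Data.Unit using (⊤; tt)
open import Data.Vec using (Vec; []; _∷_; lookup; tabulate; _[_]≔_; _++_)
import Data.Vec as V
import Data.Vec.Properties as V
open import Function using (_∘_; id; _⇔_; mk⇔; Equivalence)
open import Relation.Nullary using (¬_; Dec; yes; no; does; contradiction; ¬?; _⊎-dec_; _×-dec_)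
open import Relation.Nullary.Decidable using (True; toWitness; map′; dec-true)
open import Relation.Binary.PropositionalEquality
  using (_≡_; _≢_; refl; sym; trans; cong; cong₂; subst; subst₂; ≢-sym; module ≡-Reasoning)

open Equivalence using (to; from)

variable
  k l m n : ℕ
  S : List LogicalRelation
  a b u v w : Vec Bool k
  P Q : BoolPred k

-- Bit flips and paths in the hypercube.

vec-ext : (∀ i → lookup u i ≡ lookup v i) → u ≡ v
vec-ext {u = u} {v} u≗v = begin
  u                   ≡⟨ V.tabulate∘lookup u ⟨
  tabulate (lookup u) ≡⟨ V.tabulate-cong u≗v ⟩
  tabulate (lookup v) ≡⟨ V.tabulate∘lookup v ⟩
  v                   ∎
  where open ≡-Reasoning

toggle : Fin k → Vec Bool k → Vec Bool k
toggle i v = v [ i ]≔ not (lookup v i)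

lookup-toggle : ∀ (i : Fin k) v → lookup (toggle i v) i ≡ not (lookup v i)
lookup-toggle i v = V.lookup∘update i v _

lookup-toggle′ : ∀ {i j : Fin k} → j ≢ i → ∀ v → lookup (toggle i v) j ≡ lookup v j
lookup-toggle′ j≢i v = V.lookup∘update′ j≢i v _

toggle-involutive : ∀ (i : Fin k) v → toggle i (toggle i v) ≡ v
toggle-involutive i v = vec-ext agree
  where
  agree : ∀ j → lookup (toggle i (toggle i v)) j ≡ lookup v j
  agree j with j Fin.≟ i
  ... | yes refl = trans (lookup-toggle i (toggle i v))
                     (trans (cong not (lookup-toggle i v)) (Bool.not-involutive _))
  ... | no  j≢i  = trans (lookup-toggle′ j≢i (toggle i v)) (lookup-toggle′ j≢i v)

toggle-comm : ∀ {i j : Fin k} → i ≢ j → ∀ v → toggle i (toggle j v) ≡ toggle j (toggle i v)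
toggle-comm {i = i} {j} i≢j v = vec-ext agree
  where
  agree : ∀ c → lookup (toggle i (toggle j v)) c ≡ lookup (toggle j (toggle i v)) c
  agree c with c Fin.≟ i | c Fin.≟ j
  ... | yes refl | yes refl = refl
  ... | yes refl | no  c≢j  = trans (lookup-toggle i (toggle j v))
    (trans (cong not (lookup-toggle′ c≢j v))
      (sym (trans (lookup-toggle′ c≢j (toggle i v)) (lookup-toggle i v))))
  ... | no  c≢i  | yes refl = trans (lookup-toggle′ c≢i (toggle j v)) (trans (lookup-toggle j v)
      (sym (trans (lookup-toggle j (toggle i v)) (cong not (lookup-toggle′ c≢i v)))))
  ... | no  c≢i  | no  c≢j  = trans (lookup-toggle′ c≢i (toggle j v)) (trans (lookup-toggle′ c≢j v)
      (sym (trans (lookup-toggle′ c≢j (toggle i v)) (lookup-toggle′ c≢i v))))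

adjacent-sym : Adjacent u v → Adjacent v u
adjacent-sym {u = u} (i , refl) = i , sym (toggle-involutive i u)

adjacent-++ˡ : ∀ (u : Vec Bool l) {v w : Vec Bool m} → Adjacent v w → Adjacent (u ++ v) (u ++ w)
adjacent-++ˡ {l} u {v} (i , refl) = l ↑ʳ i , trans
  (sym (V.[]≔-++-↑ʳ u v i))
  (cong (λ x → (u ++ v) [ l ↑ʳ i ]≔ not x) (sym (V.lookup-++ʳ u v i)))

adjacent-++ʳ : ∀ {u v : Vec Bool m} (w : Vec Bool l) → Adjacent u v → Adjacent (u ++ w) (v ++ w)
adjacent-++ʳ {l = l} {u} w (i , refl) = i ↑ˡ l , trans
  (sym (V.[]≔-++-↑ˡ u w i))
  (cong (λ x → (u ++ w) [ i ↑ˡ l ]≔ not x) (sym (V.lookup-++ˡ u w i)))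

path-source : Path P u v → P u
path-source (here Pu)     = Pu
path-source (step Pu _ _) = Pu

path-target : Path P u v → P v
path-target (here Pu)    = Pu
path-target (step _ _ p) = path-target p

path-trans : Path P u v → Path P v w → Path P u w
path-trans (here _)         q = q
path-trans (step Pu adj p) q = step Pu adj (path-trans p q)

path-sym : Path P u v → Path P v u
path-sym (here Pu)       = here Pu
path-sym (step Pu adj p) =
  path-trans (path-sym p) (step (path-source p) (adjacent-sym adj) (here Pu))

path-map : ∀ {P : BoolPred k} {Q : BoolPred l} (f : Vec Bool k → Vec Bool l) →
           (∀ {x y} → Adjacent x y → Adjacent (f x) (f y)) → (∀ {x} → P x → Q (f x)) →
           Path P u v → Path Q (f u) (f v)
path-map f f-adj PQ (here Pu)       = here (PQ Pu)
path-map f f-adj PQ (step Pu adj p) = step (PQ Pu) (f-adj adj) (path-map f f-adj PQ p)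

path-mono : (∀ {x} → P x → Q x) → Path P u v → Path Q u v
path-mono = path-map id id

-- Substitution of terms for variables

evalArgs-tabulate : ∀ (v : Vec Bool n) (f : Fin k → Term n) →
                    evalArgs v (tabulate f) ≡ tabulate (evalTerm v ∘ f)
evalArgs-tabulate v f = sym (V.tabulate-∘ (evalTerm v) f)

leftVars : ∀ n m → Vec (Term (n + m)) n
leftVars n m = tabulate (λ i → var (i ↑ˡ m))

rightVars : ∀ n m → Vec (Term (n + m)) m
rightVars n m = tabulate (λ i → var (n ↑ʳ i))

eval-leftVars : ∀ (a : Vec Bool n) (w : Vec Bool m) → evalArgs (a ++ w) (leftVars n m) ≡ a
eval-leftVars a w = trans (evalArgs-tabulate (a ++ w) _)
  (trans (V.tabulate-cong (V.lookup-++ˡ a w)) (V.tabulate∘lookup a))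

eval-rightVars : ∀ (a : Vec Bool n) (w : Vec Bool m) → evalArgs (a ++ w) (rightVars n m) ≡ w
eval-rightVars a w = trans (evalArgs-tabulate (a ++ w) _)
  (trans (V.tabulate-cong (V.lookup-++ʳ a w)) (V.tabulate∘lookup w))

substTerm : Vec (Term n) k → Term k → Term n
substTerm ts (var i)   = lookup ts i
substTerm ts (const b) = const b

substArgs : Vec (Term n) k → Vec (Term k) l → Vec (Term n) l
substArgs ts = V.map (substTerm ts)

substClause : Vec (Term n) k → SClause S k → SClause S n
substClause ts c = record { idx = SClause.idx c ; args = substArgs ts (SClause.args c) }

eval-substTerm : ∀ (v : Vec Bool n) (ts : Vec (Term n) k) t →
                 evalTerm v (substTerm ts t) ≡ evalTerm (evalArgs v ts) t
eval-substTerm v ts (var i)   = sym (V.lookup-map i (evalTerm v) ts)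
eval-substTerm v ts (const b) = refl

eval-substArgs : ∀ (v : Vec Bool n) (ts : Vec (Term n) k) (us : Vec (Term k) l) →
                 evalArgs v (substArgs ts us) ≡ evalArgs (evalArgs v ts) us
eval-substArgs v ts us = trans (sym (V.map-∘ _ _ us)) (V.map-cong (eval-substTerm v ts) us)

eval-++ : ∀ (v : Vec Bool n) (ts : Vec (Term n) k) (us : Vec (Term n) l) →
          evalArgs v (ts V.++ us) ≡ evalArgs v ts ++ evalArgs v us
eval-++ v ts us = V.map-++ (evalTerm v) ts us

substCNF : Vec (Term n) k → CNF S k → CNF S n
substCNF ts = L.map (substClause ts)

sat-subst : ∀ {S} (φ : CNF S k) (ts : Vec (Term n) k) v →
            Sat (substCNF ts φ) v ⇔ Sat φ (evalArgs v ts)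
sat-subst {S = S} φ ts v = mk⇔ (All.map (λ {c} → subst (Holds c) (eval c)) ∘ All.map⁻)
                       (All.map⁺ ∘ All.map (λ {c} → subst (Holds c) (sym (eval c))))
  where
  Holds : (c : SClause S _) → Vec Bool _ → Set
  Holds c x = rel (L.lookup S (SClause.idx c)) x ≡ true
  eval : ∀ c → evalArgs v (substArgs ts (SClause.args c)) ≡ evalArgs (evalArgs v ts) (SClause.args c)
  eval c = eval-substArgs v ts (SClause.args c)

sat-subst-≡ : ∀ {S} (φ : CNF S k) {ts : Vec (Term n) k} {v} → evalArgs v ts ≡ u →
              Sat (substCNF ts φ) v ⇔ Sat φ u
sat-subst-≡ φ refl = sat-subst φ _ _

-- Faithfully expressible predicates

-- Stated for predicates, because intermediate ones may be empty. `connected` ranges over all `a`;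
-- where `P a` fails the fibre is empty by `sound`, so this agrees with faithful expressibility.
record FE (S : List LogicalRelation) (P : BoolPred k) : Set where
  field
    {aux}     : ℕ
    formula   : CNF S (k + aux)
    sound     : ∀ {a : Vec Bool k} {w : Vec Bool aux} → Sat formula (a ++ w) → P a
    complete  : ∀ {a : Vec Bool k} → P a → Σ (Vec Bool aux) λ w → Sat formula (a ++ w)
    connected : ∀ (a : Vec Bool k) → Connected {aux} (λ w → Sat formula (a ++ w))
    shared    : ∀ {a b : Vec Bool k} → P a → P b → Adjacent a b →
                Σ (Vec Bool aux) λ w → Sat formula (a ++ w) × Sat formula (b ++ w)

open FE

FE⇒FaithfullyExpressible : ∀ R → FE S (λ v → rel R v ≡ true) → FaithfullyExpressible S R
FE⇒FaithfullyExpressible R F =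
  _ , formula F , (λ a → complete F , λ (w , s) → sound F s) , (λ a _ → connected F a) ,
  λ a b → shared F

FE-cong : (∀ v → P v ⇔ Q v) → FE S P → FE S Q
FE-cong P⇔Q F = record
  { formula   = formula F
  ; sound     = λ s → to (P⇔Q _) (sound F s)
  ; complete  = λ Qa → complete F (from (P⇔Q _) Qa)
  ; connected = connected F
  ; shared    = λ Qa Qb → shared F (from (P⇔Q _) Qa) (from (P⇔Q _) Qb)
  }

connected-[] : (P : BoolPred 0) → Connected P
connected-[] P [] [] P[] _ = here P[]

FE-⊤ : FE {k} S (λ _ → ⊤)
FE-⊤ = record
  { aux = 0 ; formula = [] ; sound = λ _ → tt ; complete = λ _ → [] , []
  ; connected = λ _ → connected-[] _ ; shared = λ _ _ _ → [] , [] , [] }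

-- Without auxiliary variables every fibre has at most one point, so the terms may be arbitrary
-- here, even with a variable repeated.
FE-atom : ∀ S (i : Fin (length S)) (ts : Vec (Term n) (arity (L.lookup S i))) →
          FE S (λ v → rel (L.lookup S i) (evalArgs v ts) ≡ true)
FE-atom {n = n} S i ts = record
  { aux = 0
  ; formula = substCNF (leftVars n 0) (c ∷ [])
  ; sound = λ { {a} {[]} s → All.head (to (equiv a) s) }
  ; complete = λ {a} Pa → [] , from (equiv a) (Pa ∷ [])
  ; connected = λ _ → connected-[] _
  ; shared = λ {a} {b} Pa Pb _ → [] , from (equiv a) (Pa ∷ []) , from (equiv b) (Pb ∷ [])
  }
  where
  c : SClause S n
  c = record { idx = i ; args = ts }
  equiv : ∀ a → Sat (substCNF (leftVars n 0) (c ∷ [])) (a ++ []) ⇔ Sat (c ∷ []) a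
  equiv a = sat-subst-≡ (c ∷ []) (eval-leftVars a [])

-- The two formulas get disjoint auxiliary variables, so each fibre is the product of the two
-- fibres, and a path moves first in one factor and then in the other.
FE-∧ : ∀ {S k} {P Q : BoolPred k} → FE S P → FE S Q → FE S (λ v → P v × Q v)
FE-∧ {S} {k} {P} {Q} F G = record
  { formula = φ
  ; sound = λ {a} {w} → sound′ a w
  ; complete = λ {a} (Pa , Qa) →
      let (w , s) = complete F Pa
          (x , t) = complete G Qa
      in w ++ x , from (equiv a w x) (s , t)
  ; connected = λ a w w′ → connected′ a w w′
  ; shared = λ {a} {b} (Pa , Qa) (Pb , Qb) adj →
      let (w , s , s′) = shared F Pa Pb adj
          (x , t , t′) = shared G Qa Qb adj
      in w ++ x , from (equiv a w x) (s , t) , from (equiv b w x) (s′ , t′)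
  }
  where
  p = aux F
  q = aux G
  aVars : Vec (Term (k + (p + q))) k
  aVars = leftVars k (p + q)
  wVars : Vec (Term (k + (p + q))) p
  wVars = substArgs (rightVars k (p + q)) (leftVars p q)
  xVars : Vec (Term (k + (p + q))) q
  xVars = substArgs (rightVars k (p + q)) (rightVars p q)
  eval-a : ∀ a w x → evalArgs (a ++ (w ++ x)) aVars ≡ a
  eval-a a w x = eval-leftVars a (w ++ x)
  eval-w : ∀ a w x → evalArgs (a ++ (w ++ x)) wVars ≡ w
  eval-w a w x = trans (eval-substArgs _ _ (leftVars p q))
    (trans (cong (λ y → evalArgs y (leftVars p q)) (eval-rightVars a (w ++ x))) (eval-leftVars w x))
  eval-x : ∀ a w x → evalArgs (a ++ (w ++ x)) xVars ≡ x
  eval-x a w x = trans (eval-substArgs _ _ (rightVars p q))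
    (trans (cong (λ y → evalArgs y (rightVars p q)) (eval-rightVars a (w ++ x))) (eval-rightVars w x))
  φ : CNF S (k + (p + q))
  φ = substCNF (aVars ++ wVars) (formula F) L.++ substCNF (aVars ++ xVars) (formula G)
  equiv : ∀ a w x → Sat φ (a ++ (w ++ x)) ⇔ (Sat (formula F) (a ++ w) × Sat (formula G) (a ++ x))
  equiv a w x = mk⇔
    (λ s → let (s₁ , s₂) = All.++⁻ (substCNF (aVars ++ wVars) (formula F)) s in to eqF s₁ , to eqG s₂)
    (λ (s₁ , s₂) → All.++⁺ (from eqF s₁) (from eqG s₂))
    where
    eqF = sat-subst-≡ (formula F) (trans (eval-++ (a ++ (w ++ x)) aVars wVars)
            (cong₂ _++_ (eval-a a w x) (eval-w a w x)))
    eqG = sat-subst-≡ (formula G) (trans (eval-++ (a ++ (w ++ x)) aVars xVars)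
            (cong₂ _++_ (eval-a a w x) (eval-x a w x)))
  sound′ : ∀ a w → Sat φ (a ++ w) → P a × Q a
  sound′ a w s with V.splitAt p w
  ... | w , x , refl = let (s₁ , s₂) = to (equiv a w x) s in sound F s₁ , sound G s₂
  connected′ : ∀ a → Connected (λ w → Sat φ (a ++ w))
  connected′ a w w′ s s′ with V.splitAt p w | V.splitAt p w′
  ... | w , x , refl | w′ , x′ , refl =
    let (s₁ , s₂) = to (equiv a w x) s
        (t₁ , t₂) = to (equiv a w′ x′) s′
    in path-trans
         (path-map (_++ x) (adjacent-++ʳ x) (λ r → from (equiv a _ x) (r , s₂))
           (connected F a w w′ s₁ t₁))
         (path-map (w′ ++_) (adjacent-++ˡ w′) (λ r → from (equiv a w′ _) (t₁ , r))
           (connected G a x x′ s₂ t₂))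

-- A path in the projected solutions lifts because consecutive points share a witness.
FE-∃ : ∀ {S k m} {P : BoolPred (k + m)} {Q : BoolPred k} → FE S P →
       (∀ {a} {w : Vec Bool m} → P (a ++ w) → Q a) →
       (∀ {a} → Q a → Σ (Vec Bool m) λ w → P (a ++ w)) →
       (∀ a → Connected {m} (λ w → P (a ++ w))) →
       (∀ {a b} → Q a → Q b → Adjacent a b →
          Σ (Vec Bool m) λ w → P (a ++ w) × P (b ++ w)) →
       FE S Q
FE-∃ {S} {k} {m} {P} {Q} F Q-sound Q-complete Q-connected Q-shared = record
  { formula = φ
  ; sound = λ {a} {w} → sound′ a w
  ; complete = λ {a} Qa →
      let (w , Pw) = Q-complete Qa
          (x , s) = complete F Pw
      in w ++ x , from (equiv a w x) s
  ; connected = connected′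
  ; shared = λ {a} {b} Qa Qb adj →
      let (w , Pa , Pb) = Q-shared Qa Qb adj
          (x , s , t) = shared F Pa Pb (adjacent-++ʳ w adj)
      in w ++ x , from (equiv a w x) s , from (equiv b w x) t
  }
  where
  p = aux F
  aVars : Vec (Term (k + (m + p))) k
  aVars = leftVars k (m + p)
  wVars : Vec (Term (k + (m + p))) m
  wVars = substArgs (rightVars k (m + p)) (leftVars m p)
  xVars : Vec (Term (k + (m + p))) p
  xVars = substArgs (rightVars k (m + p)) (rightVars m p)
  φ : CNF S (k + (m + p))
  φ = substCNF ((aVars ++ wVars) ++ xVars) (formula F)
  eval : ∀ a w x → evalArgs (a ++ (w ++ x)) ((aVars ++ wVars) ++ xVars) ≡ (a ++ w) ++ x
  eval a w x = trans (eval-++ s (aVars ++ wVars) xVars) (cong₂ _++_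
    (trans (eval-++ s aVars wVars) (cong₂ _++_ (eval-leftVars a (w ++ x))
      (trans (eval-substArgs s _ (leftVars m p))
        (trans (cong (λ y → evalArgs y (leftVars m p)) (eval-rightVars a (w ++ x)))
          (eval-leftVars w x)))))
    (trans (eval-substArgs s _ (rightVars m p))
      (trans (cong (λ y → evalArgs y (rightVars m p)) (eval-rightVars a (w ++ x)))
        (eval-rightVars w x))))
    where s = a ++ (w ++ x)
  equiv : ∀ a w x → Sat φ (a ++ (w ++ x)) ⇔ Sat (formula F) ((a ++ w) ++ x)
  equiv a w x = sat-subst-≡ (formula F) (eval a w x)
  sound′ : ∀ a w → Sat φ (a ++ w) → Q a
  sound′ a w s with V.splitAt m w
  ... | w , x , refl = Q-sound (sound F (to (equiv a w x) s))
  lift : ∀ a {w w′} → Path (λ w → P (a ++ w)) w w′ → ∀ x x′ →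
         Sat (formula F) ((a ++ w) ++ x) → Sat (formula F) ((a ++ w′) ++ x′) →
         Path (λ y → Sat φ (a ++ y)) (w ++ x) (w′ ++ x′)
  lift a {w} (here _) x x′ s s′ =
    path-map (w ++_) (adjacent-++ˡ w) (from (equiv a w _)) (connected F (a ++ w) x x′ s s′)
  lift a {w} (step Pw adj path) x x′ s s′ =
    let (y , t , t′) = shared F Pw (path-source path) (adjacent-++ˡ a adj)
    in path-trans
         (path-map (w ++_) (adjacent-++ˡ w) (from (equiv a w _)) (connected F (a ++ w) x y s t))
         (step (from (equiv a w y) t) (adjacent-++ʳ y adj) (lift a path y x′ t′ s′))
  connected′ : ∀ a → Connected (λ w → Sat φ (a ++ w))
  connected′ a w w′ s s′ with V.splitAt m w | V.splitAt m w′
  ... | w , x , refl | w′ , x′ , refl =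
    let t = to (equiv a w x) s
        t′ = to (equiv a w′ x′) s′
    in lift a (Q-connected a w w′ (sound F t) (sound F t′)) x x′ t t′

-- Linear substitutions and quantification of a single bit.

Apart : Term n → Term n → Set
Apart (var x) (var y) = x ≢ y
Apart _       _       = ⊤

apart? : ∀ (s t : Term n) → Dec (Apart s t)
apart? (var x)   (var y)   = ¬? (x Fin.≟ y)
apart? (var _)   (const _) = yes tt
apart? (const _) _         = yes tt

-- A variable occurring twice would turn the flip of one bit into the flip of two, whereas `shared`
-- speaks about neighbours only.
Linear : Vec (Term n) k → Set
Linear ts = ∀ c d → c ≡ d ⊎ Apart (lookup ts c) (lookup ts d)

linear? : ∀ (ts : Vec (Term n) k) → Dec (Linear ts)
linear? ts = Fin.all? λ c → Fin.all? λ d → (c Fin.≟ d) ⊎-dec apart? (lookup ts c) (lookup ts d)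

isVar? : ∀ (t : Term n) i → Dec (t ≡ var i)
isVar? (const _) i = no λ ()
isVar? (var j)   i with j Fin.≟ i
... | yes refl = yes refl
... | no  j≢i  = no λ { refl → j≢i refl }

eval-toggle : ∀ {i} (t : Term n) → t ≢ var i → ∀ v → evalTerm (toggle i v) t ≡ evalTerm v t
eval-toggle (var j)   t≢i v = lookup-toggle′ (t≢i ∘ cong var) v
eval-toggle (const _) _   v = refl

-- The flipped variable either occurs nowhere in `ts`, and nothing changes, or by linearity at
-- exactly one position, and that position alone is flipped.
evalArgs-adjacent : ∀ (ts : Vec (Term n) k) → Linear ts → ∀ {a b} → Adjacent a b →
                    evalArgs a ts ≡ evalArgs b ts ⊎ Adjacent (evalArgs a ts) (evalArgs b ts)
evalArgs-adjacent ts lin {a} (i , refl) with Fin.any? (λ c → isVar? (lookup ts c) i)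
... | no  i∉ts = inj₁ (vec-ext λ c → trans (V.lookup-map c (evalTerm a) ts) (sym
                   (trans (V.lookup-map c (evalTerm (toggle i a)) ts)
                     (eval-toggle (lookup ts c) (λ c≡i → i∉ts (c , c≡i)) a))))
... | yes (c , c≡i) = inj₂ (c , vec-ext agree)
  where
  eval : ∀ v d → lookup (evalArgs v ts) d ≡ evalTerm v (lookup ts d)
  eval v d = V.lookup-map d (evalTerm v) ts
  agree : ∀ d → lookup (evalArgs (toggle i a) ts) d ≡ lookup (toggle c (evalArgs a ts)) d
  agree d with d Fin.≟ c
  ... | yes refl = begin
    lookup (evalArgs (toggle i a) ts) c  ≡⟨ eval (toggle i a) c ⟩
    evalTerm (toggle i a) (lookup ts c)  ≡⟨ cong (evalTerm (toggle i a)) c≡i ⟩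
    lookup (toggle i a) i                ≡⟨ lookup-toggle i a ⟩
    not (lookup a i)                     ≡⟨ cong (not ∘ evalTerm a) c≡i ⟨
    not (evalTerm a (lookup ts c))       ≡⟨ cong not (eval a c) ⟨
    not (lookup (evalArgs a ts) c)       ≡⟨ lookup-toggle c (evalArgs a ts) ⟨
    lookup (toggle c (evalArgs a ts)) c  ∎
    where open ≡-Reasoning
  ... | no  d≢c = begin
    lookup (evalArgs (toggle i a) ts) d  ≡⟨ eval (toggle i a) d ⟩
    evalTerm (toggle i a) (lookup ts d)  ≡⟨ eval-toggle (lookup ts d) d≢i a ⟩
    evalTerm a (lookup ts d)             ≡⟨ eval a d ⟨
    lookup (evalArgs a ts) d             ≡⟨ lookup-toggle′ d≢c (evalArgs a ts) ⟨
    lookup (toggle c (evalArgs a ts)) d  ∎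
    where
    open ≡-Reasoning
    d≢i : lookup ts d ≢ var i
    d≢i d≡i with lin d c
    ... | inj₁ d≡c   = d≢c d≡c
    ... | inj₂ apart = subst₂ Apart d≡i c≡i apart refl

FE-subst : ∀ {S k n} {P : BoolPred k} (ts : Vec (Term n) k) → Linear ts → FE S P →
           FE S (λ v → P (evalArgs v ts))
FE-subst {S} {k} {n} {P} ts lin F = record
  { formula = φ
  ; sound = λ {a} {w} s → sound F (to (equiv a w) s)
  ; complete = λ {a} Pa → map₂ (from (equiv a _)) (complete F Pa)
  ; connected = λ a w w′ s s′ → path-mono (from (equiv a _))
      (connected F (evalArgs a ts) w w′ (to (equiv a w) s) (to (equiv a w′) s′))
  ; shared = shared′
  }
  where
  p = aux F
  us : Vec (Term (n + p)) k
  us = substArgs (leftVars n p) ts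
  φ : CNF S (n + p)
  φ = substCNF (us ++ rightVars n p) (formula F)
  equiv : ∀ a w → Sat φ (a ++ w) ⇔ Sat (formula F) (evalArgs a ts ++ w)
  equiv a w = sat-subst-≡ (formula F) (trans (eval-++ (a ++ w) us (rightVars n p)) (cong₂ _++_
    (trans (eval-substArgs (a ++ w) (leftVars n p) ts)
      (cong (λ x → evalArgs x ts) (eval-leftVars a w)))
    (eval-rightVars a w)))
  shared′ : ∀ {a b} → P (evalArgs a ts) → P (evalArgs b ts) → Adjacent a b →
            Σ (Vec Bool p) λ w → Sat φ (a ++ w) × Sat φ (b ++ w)
  shared′ {a} {b} Pa Pb adj with evalArgs-adjacent ts lin adj
  ... | inj₂ adj′ = let (w , s , t) = shared F Pa Pb adj′ in
                    w , from (equiv a w) s , from (equiv b w) t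
  ... | inj₁ eq   = let (w , s) = complete F Pa in
                    w , from (equiv a w) s ,
                    from (equiv b w) (subst (λ x → Sat (formula F) (x ++ w)) eq s)

FE-rename : ∀ {S k n} {P : BoolPred k} (ts : Vec (Term n) k) {lin : True (linear? ts)} →
            FE S P → FE S (λ v → P (evalArgs v ts))
FE-rename ts {lin} = FE-subst ts (toWitness lin)

connected-singleton : (P : BoolPred 1) → Connected P
connected-singleton P (x ∷ []) (y ∷ []) Px Py with y Bool.≟ x
... | yes refl = here Px
... | no  y≢x  = step Px (zero , cong (_∷ []) (Bool.¬-not y≢x)) (here Py)

-- The fibres of a single bit are always connected, so only adjacent solutions need attention.
FE-∃₁ : ∀ {S k} {P : BoolPred (suc k)} {Q : BoolPred k} → FE S P →
        (∀ {y a} → P (y ∷ a) → Q a) → (∀ {a} → Q a → ∃[ y ] P (y ∷ a)) →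
        (∀ {a b} → Q a → Q b → Adjacent a b → ∃[ y ] (P (y ∷ a) × P (y ∷ b))) →
        FE S Q
FE-∃₁ {S} {k} {P} {Q} F Q-sound Q-complete Q-shared =
  FE-∃ {m = 1} (FE-subst ts lin F)
    (λ { {a} {y ∷ []} Pya → Q-sound (subst P (eval a y) Pya) })
    (λ {a} Qa → let (y , Pya) = Q-complete Qa in y ∷ [] , subst P (sym (eval a y)) Pya)
    (λ a → connected-singleton _)
    (λ {a} {b} Qa Qb adj → let (y , Pya , Pyb) = Q-shared Qa Qb adj in
       y ∷ [] , subst P (sym (eval a y)) Pya , subst P (sym (eval b y)) Pyb)
  where
  ts : Vec (Term (k + 1)) (suc k)
  ts = var (k ↑ʳ zero) ∷ leftVars k 1
  eval : ∀ a y → evalArgs (a ++ (y ∷ [])) ts ≡ y ∷ a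
  eval a y = cong₂ _∷_ (V.lookup-++ʳ a (y ∷ []) zero) (eval-leftVars a (y ∷ []))
  left : ∀ i → lookup (leftVars k 1) i ≡ var (i ↑ˡ 1)
  left i = V.lookup∘tabulate _ i
  left≢right : ∀ i → i ↑ˡ 1 ≢ k ↑ʳ zero
  left≢right i eq with trans (sym (Fin.splitAt-↑ˡ k i 1))
                         (trans (cong (splitAt k) eq) (Fin.splitAt-↑ʳ k 1 zero))
  ... | ()
  lin : Linear ts
  lin zero    zero    = inj₁ refl
  lin zero    (suc d) rewrite left d = inj₂ (≢-sym (left≢right d))
  lin (suc c) zero    rewrite left c = inj₂ (left≢right c)
  lin (suc c) (suc d) rewrite left c | left d with c Fin.≟ d
  ... | yes c≡d = inj₁ (cong suc c≡d)
  ... | no  c≢d = inj₂ (c≢d ∘ Fin.↑ˡ-injective 1 c d)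

-- Clauses

record TwoClauses (S : List LogicalRelation) : Set where
  field
    or   : FE {2} S (_≢ false ∷ false ∷ [])
    nand : FE {2} S (_≢ true ∷ true ∷ [])

open TwoClauses

linear-pair : ∀ {s t : Term n} → Apart s t → Linear (s ∷ t ∷ [])
linear-pair                     s#t zero       zero       = inj₁ refl
linear-pair                     s#t zero       (suc zero) = inj₂ s#t
linear-pair {s = var _} {var _} s#t (suc zero) zero       = inj₂ (≢-sym s#t)
linear-pair {s = var _} {const _} s#t (suc zero) zero     = inj₂ tt
linear-pair {s = const _} {var _} s#t (suc zero) zero     = inj₂ tt
linear-pair {s = const _} {const _} s#t (suc zero) zero   = inj₂ tt
linear-pair                     s#t (suc zero) (suc zero) = inj₁ refl

linear-vars : ∀ (f : Fin k → Fin n) → (∀ {c d} → f c ≡ f d → c ≡ d) →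
              Linear (tabulate (var ∘ f))
linear-vars f f-inj c d
  rewrite V.lookup∘tabulate (var ∘ f) c | V.lookup∘tabulate (var ∘ f) d with c Fin.≟ d
... | yes c≡d = inj₁ c≡d
... | no  c≢d = inj₂ (c≢d ∘ f-inj)

-- The auxiliary bit z satisfies ¬ (x ∧ z) and z ∨ y. Of two adjacent solutions either both have y
-- true, and z = `false` serves both, or both have x false, and z = `true` does.
FE-→ : TwoClauses S → FE {2} S (_≢ true ∷ false ∷ [])
FE-→ {S} tc = FE-∃₁ (FE-∧ (FE-rename (var 1F ∷ var 0F ∷ []) (nand tc)) (FE-rename (var 0F ∷ var 2F ∷ []) (or tc)))
  (λ { {false} (_ , p) refl → p refl ; {true} (p , _) refl → p refl })
  (λ { {false ∷ _ ∷ []}     _ → true , (λ ()) , (λ ())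
     ; {true ∷ true ∷ []}   _ → false , (λ ()) , (λ ())
     ; {true ∷ false ∷ []}  p → contradiction refl p })
  λ { {_ ∷ true ∷ []}      p q (zero , refl) → false , ((λ ()) , (λ ())) , ((λ ()) , (λ ()))
    ; {true ∷ false ∷ []}  p q (zero , refl) → contradiction refl p
    ; {false ∷ false ∷ []} p q (zero , refl) → contradiction refl q
    ; {false ∷ _ ∷ []}     p q (suc zero , refl) → true , ((λ ()) , (λ ())) , ((λ ()) , (λ ()))
    ; {true ∷ false ∷ []}  p q (suc zero , refl) → contradiction refl p
    ; {true ∷ true ∷ []}   p q (suc zero , refl) → contradiction refl q }

FE-clause₂ : TwoClauses S → ∀ {s t : Term n} → Apart s t → ∀ α β →
             FE S (λ v → ¬ (evalTerm v s ≡ α × evalTerm v t ≡ β))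
FE-clause₂ tc {s} {t} s#t α β =
  FE-cong (λ v → mk⇔ (λ p (eq , eq′) → p (cong₂ (λ x y → x ∷ y ∷ []) eq eq′))
                     (λ p eq → p (V.∷-injectiveˡ eq , V.∷-injectiveˡ (V.∷-injectiveʳ eq))))
    (clause α β)
  where
  clause : ∀ α β → FE _ (λ v → evalTerm v s ∷ evalTerm v t ∷ [] ≢ α ∷ β ∷ [])
  clause true  true  = FE-subst (s ∷ t ∷ []) (linear-pair s#t) (nand tc)
  clause true  false = FE-subst (s ∷ t ∷ []) (linear-pair s#t) (FE-→ tc)
  clause false true  = FE-cong
    (λ v → mk⇔ (λ p eq → p (swap eq)) (λ p eq → p (swap eq)))
    (FE-subst (t ∷ s ∷ []) (linear-pair t#s) (FE-→ tc))
    where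
    swap : ∀ {x y x′ y′ : Bool} → x Vec.∷ y ∷ [] ≡ x′ ∷ y′ ∷ [] → y Vec.∷ x ∷ [] ≡ y′ ∷ x′ ∷ []
    swap refl = refl
    apart-sym : ∀ (s t : Term _) → Apart s t → Apart t s
    apart-sym (var _)   (var _)   s#t = ≢-sym s#t
    apart-sym (var _)   (const _) _   = tt
    apart-sym (const _) (var _)   _   = tt
    apart-sym (const _) (const _) _   = tt
    t#s : Apart t s
    t#s = apart-sym s t s#t
  clause false false = FE-subst (s ∷ t ∷ []) (linear-pair s#t) (or tc)

ThreeClauses : List LogicalRelation → Set
ThreeClauses S = ∀ (ρ : Vec Bool 3) → FE S (_≢ ρ)

-- Induction on the length. A fresh bit z replaces the first two literals: z implies one of them,
-- and z stands at the head of the shorter clause, where it occurs positively; hence the fixed head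
-- `false`. A single flip changes only one side of this split, so the other side selects a value of
-- z that fits both ends.
FE-false∷clause : TwoClauses S → ThreeClauses S → ∀ (c : Vec Bool k) → FE S (_≢ false ∷ c)
FE-false∷clause tc th [] =
  FE-cong (λ { (x ∷ []) → mk⇔ (λ p eq → p (V.∷-injectiveˡ eq , refl)) (λ { p (refl , _) → p refl }) })
    (FE-clause₂ tc {s = var zero} {const false} tt false false)
FE-false∷clause {S = S} {k = suc k} tc th (x₀ ∷ c) = FE-∃₁ {P = Clause}
  (FE-cong (λ { (_ ∷ _ ∷ _ ∷ _) → mk⇔ id id }) (FE-∧ (FE-rename (var 1F ∷ var 2F ∷ var 0F ∷ []) (th (false ∷ x₀ ∷ true ∷ [])))
        (FE-cong (λ v → mk⇔ (subst (_≢ false ∷ c) (eval v)) (subst (_≢ false ∷ c) (sym (eval v))))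
          (FE-subst (tabulate (var ∘ f)) (linear-vars f f-inj) (FE-false∷clause tc th c)))))
  (λ { {false} {_ ∷ _ ∷ _} (_ , p) refl → p refl ; {true} {_ ∷ _ ∷ _} (p , _) refl → p refl })
  complete′ shared′
  where
  f : Fin (suc k) → Fin (3 + k)
  f zero    = zero
  f (suc i) = suc (suc (suc i))
  f-inj : ∀ {i j} → f i ≡ f j → i ≡ j
  f-inj {zero}  {zero}  _    = refl
  f-inj {suc _} {suc _} refl = refl
  eval : ∀ (v : Vec Bool (3 + k)) → evalArgs v (tabulate (var ∘ f)) ≡ V.head v ∷ V.tail (V.tail (V.tail v))
  eval (y ∷ _ ∷ _ ∷ v) = cong (y ∷_) (trans (evalArgs-tabulate (y ∷ _ ∷ _ ∷ v) _) (V.tabulate∘lookup v))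
  Clause : BoolPred (3 + k)
  Clause (z ∷ y ∷ x ∷ v) = y ∷ x ∷ z ∷ [] ≢ false ∷ x₀ ∷ true ∷ [] × z ∷ v ≢ false ∷ c
  Left : Bool → Bool → Set
  Left y x = y ≡ true ⊎ x ≢ x₀
  left? : ∀ y x → Dec (Left y x)
  left? y x = (y Bool.≟ true) ⊎-dec ¬? (x Bool.≟ x₀)
  with-true : ∀ {y x v} → Left y x → Clause (true ∷ y ∷ x ∷ v)
  with-true (inj₁ refl) = (λ ()) , λ ()
  with-true (inj₂ x≢x₀) = (λ { refl → x≢x₀ refl }) , λ ()
  with-false : ∀ {y x v} → v ≢ c → Clause (false ∷ y ∷ x ∷ v)
  with-false v≢c = (λ ()) , v≢c ∘ V.∷-injectiveʳ
  right : ∀ {y x v} → y ∷ x ∷ v ≢ false ∷ x₀ ∷ c → ¬ Left y x → v ≢ c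
  right {true}  p ¬l refl = ¬l (inj₁ refl)
  right {false} p ¬l refl = ¬l (inj₂ λ { refl → p refl })
  left : ∀ {y x v} → y ∷ x ∷ v ≢ false ∷ x₀ ∷ c → v ≡ c → Left y x
  left {y} {x} p v≡c with left? y x
  ... | yes l = l
  ... | no ¬l = contradiction v≡c (right p ¬l)
  complete′ : ∀ {a} → a ≢ false ∷ x₀ ∷ c → ∃[ z ] Clause (z ∷ a)
  complete′ {y ∷ x ∷ v} p with left? y x
  ... | yes l = true , with-true l
  ... | no ¬l = false , with-false (right p ¬l)
  same-right : ∀ {y x y′ x′ v} → y ∷ x ∷ v ≢ false ∷ x₀ ∷ c → y′ ∷ x′ ∷ v ≢ false ∷ x₀ ∷ c →
               ∃[ z ] (Clause (z ∷ y ∷ x ∷ v) × Clause (z ∷ y′ ∷ x′ ∷ v))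
  same-right {v = v} p q with V.≡-dec Bool._≟_ v c
  ... | yes v≡c = true , with-true (left p v≡c) , with-true (left q v≡c)
  ... | no  v≢c = false , with-false v≢c , with-false v≢c
  shared′ : ∀ {a b} → a ≢ false ∷ x₀ ∷ c → b ≢ false ∷ x₀ ∷ c → Adjacent a b →
            ∃[ z ] (Clause (z ∷ a) × Clause (z ∷ b))
  shared′ {y ∷ x ∷ v} p q (zero , refl)        = same-right p q
  shared′ {y ∷ x ∷ v} p q (suc zero , refl)    = same-right p q
  shared′ {y ∷ x ∷ v} p q (suc (suc i) , refl) with left? y x
  ... | yes l = true , with-true l , with-true l
  ... | no ¬l = false , with-false (right p ¬l) , with-false (right q ¬l)

-- The head that the induction requires is set to the constant `false`.
FE-clause : TwoClauses S → ThreeClauses S → ∀ (c : Vec Bool k) → FE S (_≢ c)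
FE-clause {k = k} tc th c = FE-cong
  (λ v → mk⇔ (λ p v≡c → p (cong (false ∷_) (trans (eval v) v≡c)))
             (λ p eq → p (trans (sym (eval v)) (V.∷-injectiveʳ eq))))
  (FE-subst ts lin (FE-false∷clause tc th c))
  where
  ts : Vec (Term k) (suc k)
  ts = const false ∷ tabulate var
  eval : ∀ v → evalArgs v (tabulate var) ≡ v
  eval v = trans (evalArgs-tabulate v var) (V.tabulate∘lookup v)
  lin : Linear ts
  lin zero    zero    = inj₁ refl
  lin zero    (suc d) = inj₂ tt
  lin (suc c) zero    rewrite V.lookup∘tabulate (var {k}) c = inj₂ tt
  lin (suc c) (suc d) with linear-vars {k} id id c d
  ... | inj₁ c≡d = inj₁ (cong suc c≡d)
  ... | inj₂ c#d = inj₂ c#d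

FE-∀ : ∀ {S k l} (P : Vec Bool l → BoolPred k) → (∀ c → FE S (P c)) → FE S (λ v → ∀ c → P c v)
FE-∀ {l = zero}  P F = FE-cong (λ v → mk⇔ (λ { p [] → p }) (λ p → p [])) (F [])
FE-∀ {l = suc l} P F = FE-cong
  (λ v → mk⇔ (λ { (p , _) (false ∷ c) → p c ; (_ , p) (true ∷ c) → p c })
             (λ p → (p ∘ (false ∷_)) , (p ∘ (true ∷_))))
  (FE-∧ (FE-∀ (P ∘ (false ∷_)) (F ∘ (false ∷_))) (FE-∀ (P ∘ (true ∷_)) (F ∘ (true ∷_))))

-- The canonical CNF: one clause for each point at which `f` fails.
FE-all : TwoClauses S → ThreeClauses S → ∀ (f : Vec Bool k → Bool) → FE S (λ v → f v ≡ true)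
FE-all {S = S} tc th f = FE-cong equiv (FE-∀ Excluded F)
  where
  Excluded : Vec Bool _ → BoolPred _
  Excluded c v = f c ≡ true ⊎ v ≢ c
  F : ∀ c → FE S (Excluded c)
  F c with f c Bool.≟ true
  ... | yes fc = FE-cong (λ v → mk⇔ (λ _ → inj₁ fc) (λ _ → tt)) FE-⊤
  ... | no ¬fc = FE-cong (λ v → mk⇔ inj₂ [ (λ fc → contradiction fc ¬fc) , id ]′) (FE-clause tc th c)
  equiv : ∀ v → (∀ c → Excluded c v) ⇔ f v ≡ true
  equiv v = mk⇔ (λ p → [ id , (λ v≢v → contradiction refl v≢v) ]′ (p v)) sound′
    where
    sound′ : f v ≡ true → ∀ c → Excluded c v
    sound′ fv c with V.≡-dec Bool._≟_ v c
    ... | yes refl = inj₁ fv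
    ... | no  v≢c  = inj₂ v≢c

-- From a detour to all three-literal clauses

-- Shifting by a fixed vector is an automorphism of the hypercube. It reduces all sign patterns of
-- the detour and of the clause to a single one.
infixl 6 _⊕_
_⊕_ : Vec Bool k → Vec Bool k → Vec Bool k
_⊕_ = V.zipWith _xor_

⊕-++ : ∀ (a b : Vec Bool k) (v w : Vec Bool l) → (a ++ v) ⊕ (b ++ w) ≡ (a ⊕ b) ++ (v ⊕ w)
⊕-++ []      []      v w = refl
⊕-++ (x ∷ a) (y ∷ b) v w = cong ((x xor y) ∷_) (⊕-++ a b v w)

⊕-cancel : ∀ (v s : Vec Bool k) → v ⊕ s ⊕ s ≡ v
⊕-cancel []          []          = refl
⊕-cancel (x ∷ v)     (false ∷ s) = cong₂ _∷_ (trans (Bool.xor-identityʳ _) (Bool.xor-identityʳ x)) (⊕-cancel v s)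
⊕-cancel (false ∷ v) (true ∷ s)  = cong (false ∷_) (⊕-cancel v s)
⊕-cancel (true ∷ v)  (true ∷ s)  = cong (true ∷_) (⊕-cancel v s)

⊕-toggle : ∀ i (v s : Vec Bool k) → toggle i v ⊕ s ≡ toggle i (v ⊕ s)
⊕-toggle zero    (false ∷ v) (y ∷ s) = refl
⊕-toggle zero    (true ∷ v)  (y ∷ s) = cong (_∷ v ⊕ s) (sym (Bool.not-involutive y))
⊕-toggle (suc i) (x ∷ v)     (y ∷ s) = cong ((x xor y) ∷_) (⊕-toggle i v s)

adjacent-⊕ : ∀ (s : Vec Bool k) {u v} → Adjacent u v → Adjacent (u ⊕ s) (v ⊕ s)
adjacent-⊕ s {u} (i , refl) = i , ⊕-toggle i u s

∧-true : ∀ {x y} → (x ≡ true × y ≡ true) ⇔ x ∧ y ≡ true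
∧-true {x} {y} = mk⇔ (λ { (refl , refl) → refl }) (λ eq → Bool.∧-conicalˡ x y eq , Bool.∧-conicalʳ x y eq)

FE-∧ᵇ : ∀ {S k} {f g : Vec Bool k → Bool} → FE S (λ v → f v ≡ true) → FE S (λ v → g v ≡ true) →
        FE S (λ v → f v ∧ g v ≡ true)
FE-∧ᵇ F G = FE-cong (λ _ → ∧-true) (FE-∧ F G)

FE-nand : TwoClauses S → ∀ (i j : Fin k) → i ≢ j → ∀ x y →
          FE S (λ v → not ((lookup v i xor x) ∧ (lookup v j xor y)) ≡ true)
FE-nand tc i j i≢j x y = FE-cong (λ v → equiv (lookup v i) x (lookup v j) y)
  (FE-clause₂ tc {s = var i} {var j} i≢j (not x) (not y))
  where
  holds : ∀ z x → z xor x ≡ true ⇔ z ≡ not x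
  holds true  x = mk⇔ sym sym
  holds false x = mk⇔ (λ { refl → refl }) (λ eq → trans (sym (Bool.not-involutive x)) (cong not (sym eq)))
  equiv : ∀ z x z′ y → (¬ (z ≡ not x × z′ ≡ not y)) ⇔ not ((z xor x) ∧ (z′ xor y)) ≡ true
  equiv z x z′ y = mk⇔
    (λ p → sym (Bool.¬-not λ eq → let (e , e′) = from ∧-true (sym eq) in
                 p (to (holds z x) e , to (holds z′ y) e′)))
    λ p (e , e′) → Bool.not-¬ refl
      (trans (to ∧-true (from (holds z x) e , from (holds z′ y) e′)) (sym p))

-- A Boolean quantifier, so that the finite checks on the gadget hold by evaluation, with `refl` as
-- proof.
forallᵇ : ∀ k → (Vec Bool k → Bool) → Bool
forallᵇ zero    f = f []
forallᵇ (suc k) f = forallᵇ k (f ∘ (false ∷_)) ∧ forallᵇ k (f ∘ (true ∷_))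

forallᵇ-sound : ∀ k (f : Vec Bool k → Bool) → forallᵇ k f ≡ true → ∀ v → f v ≡ true
forallᵇ-sound zero    f eq []          = eq
forallᵇ-sound (suc k) f eq (false ∷ v) = forallᵇ-sound k _ (proj₁ (from ∧-true eq)) v
forallᵇ-sound (suc k) f eq (true ∷ v)  = forallᵇ-sound k _ (proj₂ (from ∧-true eq)) v

-- The path 100, 101, 001, 011, 010: its ends are at Hamming distance 2 but at distance 4 along it.
detour : Vec Bool 3 → Bool
detour (p ∷ q ∷ t ∷ []) = (p ∨ q ∨ t) ∧ not (p ∧ q)

-- Two detours whose third bits exclude each other form the boundary of a 5 × 5 grid, a cycle.
-- Each of x, y, z confines the solution to an arc of it; any two of these arcs meet in an arc,
-- but the three have no common point.
gadget : Vec Bool 9 → Bool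
gadget (x ∷ y ∷ z ∷ p ∷ q ∷ t ∷ p′ ∷ q′ ∷ t′ ∷ []) =
  detour (p ∷ q ∷ t ∷ []) ∧ detour (p′ ∷ q′ ∷ t′ ∷ []) ∧ not (t ∧ t′) ∧
  not (q ∧ x) ∧ not (q′ ∧ y) ∧ not (p ∧ z) ∧ not (p′ ∧ z)

forallᵇ-⇒ : ∀ k (f g : Vec Bool k → Bool) → forallᵇ k (λ v → not (f v) ∨ g v) ≡ true →
            ∀ v → f v ≡ true → g v ≡ true
forallᵇ-⇒ k f g eq v fv with forallᵇ-sound k _ eq v
... | h rewrite fv = h

notAll : Vec Bool 3 → Bool
notAll (x ∷ y ∷ z ∷ []) = not (x ∧ y ∧ z)

gadget-sound : ∀ a w → gadget (a ++ w) ≡ true → notAll a ≡ true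
gadget-sound a w = forallᵇ-⇒ 6 (λ w → gadget (a ++ w)) (λ _ → notAll a)
  (forallᵇ-sound 3 (λ a → forallᵇ 6 λ w → not (gadget (a ++ w)) ∨ notAll a) refl a) w

-- Determined by the maximal a, since the fibres of the gadget shrink as a grows.
witness : Vec Bool 3 → Vec Bool 6
witness (_ ∷ _     ∷ false ∷ []) = true  ∷ false ∷ false ∷ true  ∷ false ∷ false ∷ []
witness (_ ∷ false ∷ true  ∷ []) = false ∷ false ∷ true  ∷ false ∷ true  ∷ false ∷ []
witness (_ ∷ true  ∷ true  ∷ []) = false ∷ true  ∷ false ∷ false ∷ false ∷ true  ∷ []

gadget-complete : ∀ a → notAll a ≡ true → gadget (a ++ witness a) ≡ true
gadget-complete = forallᵇ-⇒ 3 notAll (λ a → gadget (a ++ witness a)) refl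

gadget-shared : ∀ a b → notAll a ≡ true → notAll b ≡ true → Adjacent a b →
                Σ (Vec Bool 6) λ w → gadget (a ++ w) ≡ true × gadget (b ++ w) ≡ true
gadget-shared a _ a≢ b≢ (i , refl) = common i a , from ∧-true (shared-at i a (to ∧-true (a≢ , b≢)))
  where
  common : Fin 3 → Vec Bool 3 → Vec Bool 6
  -- The disjunction is the larger of the two neighbours, itself not all true, and its witness also
  -- serves the smaller one.
  common i a = witness (V.zipWith _∨_ a (toggle i a))
  sat both : Fin 3 → Vec Bool 3 → Bool
  sat i a = notAll a ∧ notAll (toggle i a)
  both i a = gadget (a ++ common i a) ∧ gadget (toggle i a ++ common i a)
  shared-at : ∀ i a → sat i a ≡ true → both i a ≡ true
  shared-at 0F = forallᵇ-⇒ 3 (sat 0F) (both 0F) refl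
  shared-at 1F = forallᵇ-⇒ 3 (sat 1F) (both 1F) refl
  shared-at 2F = forallᵇ-⇒ 3 (sat 2F) (both 2F) refl

-- The coordinate to toggle in order to move along a detour; next moves around the cycle.
forward backward : Bool → Bool → Bool → Fin 3
forward  true  _     true  = 0F
forward  false false true  = 1F
forward  _     _     _     = 2F
backward _     true  true  = 1F
backward false false true  = 0F
backward _     _     _     = 2F

next : Vec Bool 6 → Fin 6
next (p ∷ q ∷ t ∷ p′ ∷ q′ ∷ t′ ∷ []) =
  -- The four sides of the grid in turn: the second detour at its start, the first at its end, the
  -- second at its end, the first at its start. Each test leaves out the corner where the next side
  -- takes over.
  if p′ ∧ not t′ ∧ not (q ∧ not t) then forward p q t ↑ˡ 3 else
  if q ∧ not t ∧ not (q′ ∧ not t′) then 3 ↑ʳ forward p′ q′ t′ else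
  if q′ ∧ not t′ ∧ not (p ∧ not t) then backward p q t ↑ˡ 3 else
  3 ↑ʳ backward p′ q′ t′

-- The last point, in the direction of next, of the arc to which x, y, z confine the cycle.
arc-end : Vec Bool 3 → Vec Bool 6
arc-end (_     ∷ false ∷ true  ∷ []) = false ∷ false ∷ true  ∷ false ∷ true  ∷ false ∷ []
arc-end (_     ∷ true  ∷ true  ∷ []) = false ∷ true  ∷ false ∷ false ∷ false ∷ true  ∷ []
arc-end (true  ∷ _     ∷ false ∷ []) = false ∷ false ∷ true  ∷ true  ∷ false ∷ false ∷ []
arc-end (false ∷ true  ∷ false ∷ []) = false ∷ true  ∷ false ∷ false ∷ false ∷ true  ∷ []
arc-end (false ∷ false ∷ false ∷ []) = true  ∷ false ∷ false ∷ true  ∷ false ∷ false ∷ []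

reaches : ℕ → (f : Vec Bool 6 → Bool) → Vec Bool 6 → Vec Bool 6 → Bool
reaches zero    f w v = false
reaches (suc n) f w v = f v ∧ (does (V.≡-dec Bool._≟_ v w) ∨ reaches n f w (toggle (next v) v))

reaches-sound : ∀ n f w v → reaches n f w v ≡ true → Path (λ x → f x ≡ true) v w
reaches-sound (suc n) f w v eq with from (∧-true {f v}) eq
... | fv , eq′ with V.≡-dec Bool._≟_ v w
... | yes refl = here fv
... | no  _    = step fv (next v , refl) (reaches-sound n f w (toggle (next v) v) eq′)

-- From every solution the walk by `next` reaches `arc-end a` inside the fibre, as exhaustive
-- evaluation confirms. Two such walks, the second reversed, join any two solutions.
gadget-connected : ∀ a → Connected (λ w → gadget (a ++ w) ≡ true)
gadget-connected a u v gu gv = path-trans (path-to-end u gu) (path-sym (path-to-end v gv))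
  where
  reached : Vec Bool 3 → Vec Bool 6 → Bool
  -- The cycle has 25 - 9 = 16 points and each unit of fuel visits one, so 17 is enough.
  reached a = reaches 17 (λ w → gadget (a ++ w)) (arc-end a)
  path-to-end : ∀ w → gadget (a ++ w) ≡ true → Path (λ w → gadget (a ++ w) ≡ true) w (arc-end a)
  path-to-end w gw = reaches-sound 17 _ (arc-end a) w
    (forallᵇ-⇒ 6 (λ w → gadget (a ++ w)) (reached a)
      (forallᵇ-sound 3 (λ a → forallᵇ 6 λ w → not (gadget (a ++ w)) ∨ reached a w) refl a) w gw)

FE-gadget : TwoClauses S → ∀ σ → FE S (λ v → detour (v ⊕ σ) ≡ true) →
            ∀ (τ : Vec Bool 3) → FE S (λ v → gadget (v ⊕ (τ ++ σ ++ σ)) ≡ true)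
FE-gadget tc (s₀ ∷ s₁ ∷ s₂ ∷ []) F (x ∷ y ∷ z ∷ []) = FE-cong
  (λ { (_ ∷ _ ∷ _ ∷ _ ∷ _ ∷ _ ∷ _ ∷ _ ∷ _ ∷ []) → mk⇔ id id })
  (FE-∧ᵇ (FE-rename (var 3F ∷ var 4F ∷ var 5F ∷ []) F)
  (FE-∧ᵇ (FE-rename (var 6F ∷ var 7F ∷ var 8F ∷ []) F)
  (FE-∧ᵇ (FE-nand tc 5F 8F (λ ()) s₂ s₂)
  (FE-∧ᵇ (FE-nand tc 4F 0F (λ ()) s₁ x)
  (FE-∧ᵇ (FE-nand tc 7F 1F (λ ()) s₁ y)
  (FE-∧ᵇ (FE-nand tc 3F 2F (λ ()) s₀ z)
         (FE-nand tc 6F 2F (λ ()) s₀ z)))))))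

three-clauses : TwoClauses S → ∀ σ → FE S (λ v → detour (v ⊕ σ) ≡ true) → ThreeClauses S
three-clauses {S} tc σ F ρ = FE-cong excluded
  (FE-∃ (FE-gadget tc σ F τ)
    (λ {a} {w} g → gadget-sound (a ⊕ τ) (w ⊕ s) (subst Holds (split a w) g))
    (λ {a} h → witness (a ⊕ τ) ⊕ s ,
      subst Holds (sym (unsplit a (witness (a ⊕ τ)))) (gadget-complete (a ⊕ τ) h))
    (λ a u v gu gv → subst₂ (Path _) (⊕-cancel u s) (⊕-cancel v s)
      (path-map (_⊕ s) (adjacent-⊕ s) (λ {w} → subst Holds (sym (unsplit a w)))
        (gadget-connected (a ⊕ τ) (u ⊕ s) (v ⊕ s)
          (subst Holds (split a u) gu) (subst Holds (split a v) gv))))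
    λ {a} {b} ha hb adj →
      let (w , ga , gb) = gadget-shared (a ⊕ τ) (b ⊕ τ) ha hb (adjacent-⊕ τ adj)
      in w ⊕ s , subst Holds (sym (unsplit a w)) ga , subst Holds (sym (unsplit b w)) gb)
  where
  τ : Vec Bool 3
  -- Shifting by the complement of `ρ` takes `ρ` to the all-true vector, the one point where
  -- `notAll` fails.
  τ = V.map not ρ
  s : Vec Bool 6
  s = σ ++ σ
  Holds : BoolPred 9
  Holds v = gadget v ≡ true
  split : ∀ a w → (a ++ w) ⊕ (τ ++ s) ≡ (a ⊕ τ) ++ (w ⊕ s)
  split a w = ⊕-++ a τ w s
  unsplit : ∀ a w → (a ++ (w ⊕ s)) ⊕ (τ ++ s) ≡ (a ⊕ τ) ++ w
  unsplit a w = trans (split a (w ⊕ s)) (cong ((a ⊕ τ) ++_) (⊕-cancel w s))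
  excluded : ∀ v → notAll (v ⊕ τ) ≡ true ⇔ v ≢ ρ
  excluded v = mk⇔ (λ { h refl → Bool.not-¬ refl (trans h (sym (forallᵇ-sound 3 complement refl ρ))) }) avoided
    where
    complement : Vec Bool 3 → Bool
    complement ρ = not (notAll (ρ ⊕ V.map not ρ))
    same avoids : Vec Bool 3 → Vec Bool 3 → Bool
    same v ρ = does (V.≡-dec Bool._≟_ v ρ)
    avoids v ρ = notAll (v ⊕ V.map not ρ)
    test : same v ρ ∨ avoids v ρ ≡ true
    test = forallᵇ-sound 3 (λ ρ → same v ρ ∨ avoids v ρ)
      (forallᵇ-sound 3 (λ v → forallᵇ 3 λ ρ → same v ρ ∨ avoids v ρ) refl v) ρ
    avoided : v ≢ ρ → avoids v ρ ≡ true
    avoided v≢ρ with V.≡-dec Bool._≟_ v ρ | test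
    ... | yes v≡ρ | _  = contradiction v≡ρ v≢ρ
    ... | no  _   | eq = eq


-- Isolating a detour

-- The variable x can occur only at position `h x`, hence not at two positions.
linear-inverse : ∀ (ts : Vec (Term n) k) (h : Fin n → Fin k) →
                 (∀ c {x} → lookup ts c ≡ var x → c ≡ h x) → Linear ts
linear-inverse ts h inv c d with c Fin.≟ d
... | yes c≡d = inj₁ c≡d
... | no  c≢d = inj₂ (apart (lookup ts c) (lookup ts d) refl refl)
  where
  apart : ∀ s s′ → lookup ts c ≡ s → lookup ts d ≡ s′ → Apart s s′
  apart (var x)   (var y)   c≡x d≡y x≡y = c≢d (trans (inv c c≡x) (trans (cong h x≡y) (sym (inv d d≡y))))
  apart (var _)   (const _) _   _   = tt
  apart (const _) _         _   _   = tt

-- Quantifies over coordinate `i` but keeps the arity: a fresh bit overwrites the old value at `i`,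
-- so no coordinate has to be renumbered.
FE-forget : ∀ {S k} {P Q : BoolPred k} (i : Fin k) → FE S P →
            (∀ {y v} → P (v [ i ]≔ y) → Q v) → (∀ {v} → Q v → ∃[ y ] P (v [ i ]≔ y)) →
            (∀ {u v} → Q u → Q v → Adjacent u v → ∃[ y ] (P (u [ i ]≔ y) × P (v [ i ]≔ y))) →
            FE S Q
FE-forget {S} {k} {P} i F = FE-∃₁ {P = λ v → P (V.tail v [ i ]≔ V.head v)}
  (FE-cong (λ v → mk⇔ (subst P (eval v)) (subst P (sym (eval v))))
    (FE-subst ts (linear-inverse ts h inverse) F))
  where
  term : Fin k → Term (suc k)
  term c with c Fin.≟ i
  ... | yes _ = var zero
  ... | no  _ = var (suc c)
  ts : Vec (Term (suc k)) k
  ts = tabulate term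
  h : Fin (suc k) → Fin k
  h zero    = i
  h (suc c) = c
  inverse : ∀ c {x} → lookup ts c ≡ var x → c ≡ h x
  inverse c eq with c Fin.≟ i | trans (sym (V.lookup∘tabulate term c)) eq
  ... | yes c≡i | refl = c≡i
  ... | no  _   | refl = refl
  eval : ∀ v → evalArgs v ts ≡ V.tail v [ i ]≔ V.head v
  eval (y ∷ v) = vec-ext agree
    where
    agree : ∀ c → lookup (evalArgs (y ∷ v) ts) c ≡ lookup (v [ i ]≔ y) c
    agree c rewrite V.lookup-map c (evalTerm (y ∷ v)) ts | V.lookup∘tabulate term c with c Fin.≟ i
    ... | yes refl = sym (V.lookup∘update i v y)
    ... | no  c≢i  = sym (V.lookup∘update′ c≢i v y)

same-or-not : ∀ x y → x ≡ y ⊎ x ≡ not y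
same-or-not x y with x Bool.≟ y
... | yes x≡y = inj₁ x≡y
... | no  x≢y = inj₂ (Bool.¬-not x≢y)

module _ {k : ℕ} (a : Vec Bool k) (t : Fin k) where

  Kept Flipped : Vec Bool k → Fin k → Set
  Kept v c    = lookup v c ≡ lookup a c
  Flipped v c = lookup v c ≡ not (lookup a c)

  -- The stages of flipping the list in order: the flipped coordinates form an initial segment.
  Chain : List (Fin k) → BoolPred k
  Chain []      v = ⊤
  Chain (i ∷ L) v = (Kept v i × All (Kept v) L) ⊎ (Flipped v i × Chain L v)

  Ends : List (Fin k) → BoolPred k
  Ends L v = All (Kept v) L ⊎ All (Flipped v) L

  -- As long as t is flipped the coordinates of L may be flipped one after the other,
  -- otherwise either none or all of them are.
  Track : List (Fin k) → BoolPred k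
  Track L v = Chain L v × (Flipped v t ⊎ Ends L v)

  Agree : List (Fin k) → Vec Bool k → Vec Bool k → Set
  Agree L u v = ∀ {c} → c ∈ L → lookup u c ≡ lookup v c

  all-cong : ∀ u v {L} (f : Bool → Bool) → Agree L u v →
             All (λ c → lookup u c ≡ f (lookup a c)) L → All (λ c → lookup v c ≡ f (lookup a c)) L
  all-cong u v f eq []       = []
  all-cong u v f eq (p ∷ ps) = trans (sym (eq (here refl))) p ∷ all-cong u v f (eq ∘ there) ps

  chain-cong : ∀ {u v} L → Agree L u v → Chain L u → Chain L v
  chain-cong []      eq _ = tt
  chain-cong {u} {v} (i ∷ L) eq (inj₁ (p , ps)) =
    inj₁ (trans (sym (eq (here refl))) p , all-cong u v id (eq ∘ there) ps)
  chain-cong {u} {v} (i ∷ L) eq (inj₂ (p , ch)) =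
    inj₂ (trans (sym (eq (here refl))) p , chain-cong L (eq ∘ there) ch)

  track-cong : ∀ {u v L} → Agree (t ∷ L) u v → Track L u → Track L v
  track-cong {u} {v} {L} eq (ch , e) = chain-cong L (eq ∘ there) ch ,
    [ (λ p → inj₁ (trans (sym (eq (here refl))) p))
    , (λ e → inj₂ ([ inj₁ ∘ all-cong u v id (eq ∘ there) , inj₂ ∘ all-cong u v not (eq ∘ there) ]′ e)) ]′ e

  agree-update : ∀ {i L} → All (i ≢_) L → ∀ v y → Agree L v (v [ i ]≔ y)
  agree-update i∉L v y c∈L = sym (V.lookup∘update′ (≢-sym (All.lookup i∉L c∈L)) v y)

  module _ {i j : Fin k} {L : List (Fin k)} (i∉ : All (i ≢_) (t ∷ j ∷ L)) where

    track-tail : ∀ {v y} → Track (i ∷ j ∷ L) (v [ i ]≔ y) → Track (j ∷ L) v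
    track-tail {v} {y} (ch , e) =
      track-cong (λ c∈ → sym (agree-update i∉ v y c∈)) (chain-tail ch , ends-tail e)
      where
      v′ = v [ i ]≔ y
      chain-tail : Chain (i ∷ j ∷ L) v′ → Chain (j ∷ L) v′
      chain-tail (inj₁ (_ , p ∷ ps)) = inj₁ (p , ps)
      chain-tail (inj₂ (_ , ch))     = ch
      ends-tail : Flipped v′ t ⊎ Ends (i ∷ j ∷ L) v′ → Flipped v′ t ⊎ Ends (j ∷ L) v′
      ends-tail (inj₁ p)               = inj₁ p
      ends-tail (inj₂ (inj₁ (_ ∷ ps))) = inj₂ (inj₁ ps)
      ends-tail (inj₂ (inj₂ (_ ∷ ps))) = inj₂ (inj₂ ps)

    -- A chain that keeps `j` keeps everything after it, so keeping `i` as well gives the first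
    -- stage of the longer track, where `t` is free.
    track-kept : ∀ {v} → Kept v j → Track (j ∷ L) v → Track (i ∷ j ∷ L) (v [ i ]≔ lookup a i)
    track-kept {v} kept T with track-cong (agree-update i∉ v (lookup a i)) T
    ... | ch , e = inj₁ (kept-i , all-kept ch) , inj₂ (inj₁ (kept-i ∷ all-kept ch))
      where
      v′ = v [ i ]≔ lookup a i
      kept-i : Kept v′ i
      kept-i = V.lookup∘update i v (lookup a i)
      kept-j : Kept v′ j
      kept-j = trans (sym (agree-update i∉ v (lookup a i) (there (here refl)))) kept
      all-kept : Chain (j ∷ L) v′ → All (Kept v′) (j ∷ L)
      all-kept (inj₁ (p , ps)) = p ∷ ps
      all-kept (inj₂ (p , _))  = contradiction p (Bool.not-¬ kept-j)

    -- With `i` flipped any chain may follow. Only the condition on the ends could break, namely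
    -- when `t` is kept and the rest is kept too, and the hypothesis excludes this.
    track-flipped : ∀ {v} → Flipped v j ⊎ Flipped v t → Track (j ∷ L) v →
                    Track (i ∷ j ∷ L) (v [ i ]≔ not (lookup a i))
    track-flipped {v} flipped T with track-cong (agree-update i∉ v (not (lookup a i))) T
    ... | ch , e = inj₂ (flipped-i , ch) , ends flipped e
      where
      v′ = v [ i ]≔ not (lookup a i)
      flipped-i : Flipped v′ i
      flipped-i = V.lookup∘update i v (not (lookup a i))
      same : Agree (t ∷ j ∷ L) v′ v
      same c∈ = sym (agree-update i∉ v (not (lookup a i)) c∈)
      ends : Flipped v j ⊎ Flipped v t → Flipped v′ t ⊎ Ends (j ∷ L) v′ → Flipped v′ t ⊎ Ends (i ∷ j ∷ L) v′
      ends _        (inj₁ p)              = inj₁ p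
      ends (inj₂ p) _                     = inj₁ (trans (same (here refl)) p)
      ends (inj₁ p) (inj₂ (inj₁ (q ∷ _))) =
        contradiction (trans (same (there (here refl))) p) (Bool.not-¬ q)
      ends _        (inj₂ (inj₂ ps))      = inj₂ (inj₂ (flipped-i ∷ ps))

  -- The value of `i` is chosen to follow `j`, so only a flip of `j` itself is delicate. If `t` is
  -- flipped, `i` flipped serves both ends. If `t` is kept, both ends have `j` and `l` in the same
  -- status, which is impossible when only `j` changes. This needs the coordinate `l`, so the
  -- shortening stops at lists of length two.
  FE-track-tail : ∀ {S i j l L} → Unique (t ∷ i ∷ j ∷ l ∷ L) →
                  FE S (Track (i ∷ j ∷ l ∷ L)) → FE S (Track (j ∷ l ∷ L))
  FE-track-tail {S} {i} {j} {l} {L} ((t≢i ∷ t≢j ∷ t≢l ∷ _) ∷ (i∉L ∷ (j≢l ∷ _) ∷ _)) F =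
    FE-forget i F (track-tail i∉) complete′ shared′
    where
    i∉ : All (i ≢_) (t ∷ j ∷ l ∷ L)
    i∉ = ≢-sym t≢i ∷ i∉L
    T = Track (j ∷ l ∷ L)
    T′ = Track (i ∷ j ∷ l ∷ L)
    complete′ : ∀ {v} → T v → ∃[ y ] T′ (v [ i ]≔ y)
    complete′ {v} Tv with same-or-not (lookup v j) (lookup a j)
    ... | inj₁ kept    = _ , track-kept i∉ kept Tv
    ... | inj₂ flipped = _ , track-flipped i∉ (inj₁ flipped) Tv
    ends-agree : ∀ u v → lookup u l ≡ lookup v l → Ends (j ∷ l ∷ L) u → Ends (j ∷ l ∷ L) v →
                 lookup u j ≡ lookup v j
    ends-agree u v eq (inj₁ (p ∷ _))     (inj₁ (q ∷ _))     = trans p (sym q)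
    ends-agree u v eq (inj₂ (p ∷ _))     (inj₂ (q ∷ _))     = trans p (sym q)
    ends-agree u v eq (inj₁ (_ ∷ p ∷ _)) (inj₂ (_ ∷ q ∷ _)) = contradiction (trans eq q) (Bool.not-¬ p)
    ends-agree u v eq (inj₂ (_ ∷ p ∷ _)) (inj₁ (_ ∷ q ∷ _)) = contradiction p (Bool.not-¬ (trans eq q))
    shared′ : ∀ {u v} → T u → T v → Adjacent u v → ∃[ y ] (T′ (u [ i ]≔ y) × T′ (v [ i ]≔ y))
    shared′ {u} Tu Tv (d , refl) with d Fin.≟ j
    ... | no d≢j with same-or-not (lookup u j) (lookup a j)
    ... | inj₁ kept    = _ , track-kept i∉ kept Tu ,
                         track-kept i∉ (trans (lookup-toggle′ (≢-sym d≢j) u) kept) Tv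
    ... | inj₂ flipped = _ , track-flipped i∉ (inj₁ flipped) Tu ,
                         track-flipped i∉ (inj₁ (trans (lookup-toggle′ (≢-sym d≢j) u) flipped)) Tv
    shared′ {u} Tu Tv (d , refl) | yes refl with same-or-not (lookup u t) (lookup a t)
    ... | inj₂ flipped = _ , track-flipped i∉ (inj₂ flipped) Tu ,
                         track-flipped i∉ (inj₂ (trans (lookup-toggle′ t≢j u) flipped)) Tv
    ... | inj₁ kept with proj₂ Tu | proj₂ Tv
    ... | inj₁ p | _      = contradiction p (Bool.not-¬ kept)
    ... | inj₂ _ | inj₁ p = contradiction p (Bool.not-¬ (trans (lookup-toggle′ t≢j u) kept))
    ... | inj₂ e | inj₂ e′ = contradiction
      (trans (ends-agree u (toggle j u) (sym (lookup-toggle′ (≢-sym j≢l) u)) e e′) (lookup-toggle j u)) (Bool.not-¬ refl)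

  FE-track : ∀ {S i j L} → Unique (t ∷ i ∷ j ∷ L) → FE S (Track (i ∷ j ∷ L)) →
             Σ (Fin k) λ x → Σ (Fin k) λ y → x ≢ y × t ≢ x × t ≢ y × FE S (Track (x ∷ y ∷ []))
  FE-track {L = []} ((t≢i ∷ t≢j ∷ []) ∷ (i≢j ∷ []) ∷ _) F = _ , _ , i≢j , t≢i , t≢j , F
  FE-track {L = _ ∷ _} uniq@((_ ∷ t∉) ∷ _ ∷ uniq′) F = FE-track (t∉ ∷ uniq′) (FE-track-tail uniq F)

  -- The three bits of `detour` say that `x` is kept, that `y` is flipped and that `t` is flipped;
  -- the point 100 is the start, with nothing flipped. The negation in the shift comes from the
  -- first bit.
  FE-track⇒detour : ∀ {S x y} → x ≢ y → t ≢ x → t ≢ y → FE S (Track (x ∷ y ∷ [])) →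
                    FE S (λ v → detour (v ⊕ (not (lookup a x) ∷ lookup a y ∷ lookup a t ∷ [])) ≡ true)
  FE-track⇒detour {S} {x} {y} x≢y t≢x t≢y F =
    FE-cong (λ { (p ∷ q ∷ r ∷ []) → equiv p q r }) (FE-subst ts (linear-inverse ts h inverse) F)
    where
    h : Fin 3 → Fin k
    h 0F = x
    h 1F = y
    h 2F = t
    term : Fin k → Term 3
    term c with Fin.any? (λ e → c Fin.≟ h e)
    ... | yes (e , _) = var e
    -- `Track` looks at `x`, `y` and `t` only, so any constant will do elsewhere.
    ... | no  _       = const false
    ts : Vec (Term 3) k
    ts = tabulate term
    inverse : ∀ c {e} → lookup ts c ≡ var e → c ≡ h e
    inverse c eq with Fin.any? (λ e → c Fin.≟ h e) | trans (sym (V.lookup∘tabulate term c)) eq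
    ... | yes (_ , c≡) | refl = c≡
    h-inj : ∀ d e → h d ≡ h e → d ≡ e
    h-inj 0F 0F _  = refl
    h-inj 0F 1F eq = contradiction eq x≢y
    h-inj 0F 2F eq = contradiction (sym eq) t≢x
    h-inj 1F 0F eq = contradiction (sym eq) x≢y
    h-inj 1F 1F _  = refl
    h-inj 1F 2F eq = contradiction (sym eq) t≢y
    h-inj 2F 0F eq = contradiction eq t≢x
    h-inj 2F 1F eq = contradiction eq t≢y
    h-inj 2F 2F _  = refl
    eval : ∀ v e → lookup (evalArgs v ts) (h e) ≡ lookup v e
    eval v e rewrite V.lookup-map (h e) (evalTerm v) ts | V.lookup∘tabulate term (h e)
      with Fin.any? (λ e′ → h e Fin.≟ h e′)
    ... | yes (e′ , eq) = cong (lookup v) (h-inj e′ e (sym eq))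
    ... | no  ∄         = contradiction (e , refl) ∄
    bits : Vec Bool k → Vec Bool 3
    bits u = (lookup u x xor not (lookup a x)) ∷ (lookup u y xor lookup a y) ∷ (lookup u t xor lookup a t) ∷ []
    bits-eval : ∀ p q r → bits (evalArgs (p ∷ q ∷ r ∷ []) ts) ≡
                (p ∷ q ∷ r ∷ []) ⊕ (not (lookup a x) ∷ lookup a y ∷ lookup a t ∷ [])
    bits-eval p q r rewrite eval (p ∷ q ∷ r ∷ []) 0F | eval (p ∷ q ∷ r ∷ []) 1F | eval (p ∷ q ∷ r ∷ []) 2F = refl
    Status : Bool → Vec Bool k → Fin k → Set
    Status b u c = if b then Flipped u c else Kept u c
    status : ∀ u c → Status (lookup u c xor lookup a c) u c
    status u c with lookup u c | lookup a c
    ... | true  | true  = refl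
    ... | true  | false = refl
    ... | false | true  = refl
    ... | false | false = refl
    status-not : ∀ u c → Status (not (lookup u c xor not (lookup a c))) u c
    status-not u c = subst (λ b → Status b u c)
      (sym (trans (cong not (sym (Bool.not-distribʳ-xor (lookup u c) _))) (Bool.not-involutive _))) (status u c)
    tracks : ∀ u p q r → Status (not p) u x → Status q u y → Status r u t →
             Track (x ∷ y ∷ []) u ⇔ detour (p ∷ q ∷ r ∷ []) ≡ true
    tracks u false false false fx ky kt = mk⇔
      (λ { (_ , inj₁ ft) → contradiction ft (Bool.not-¬ kt)
         ; (_ , inj₂ (inj₁ (kx ∷ _))) → contradiction fx (Bool.not-¬ kx)
         ; (_ , inj₂ (inj₂ (_ ∷ fy ∷ _))) → contradiction fy (Bool.not-¬ ky) })
      λ ()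
    tracks u false false true  fx ky ft = mk⇔ (λ _ → refl) λ _ → inj₂ (fx , inj₁ (ky , [])) , inj₁ ft
    tracks u false true  false fx fy kt = mk⇔ (λ _ → refl) λ _ →
      inj₂ (fx , inj₂ (fy , tt)) , inj₂ (inj₂ (fx ∷ fy ∷ []))
    tracks u false true  true  fx fy ft = mk⇔ (λ _ → refl) λ _ → inj₂ (fx , inj₂ (fy , tt)) , inj₁ ft
    tracks u true  false false kx ky kt = mk⇔ (λ _ → refl) λ _ →
      inj₁ (kx , ky ∷ []) , inj₂ (inj₁ (kx ∷ ky ∷ []))
    tracks u true  false true  kx ky ft = mk⇔ (λ _ → refl) λ _ → inj₁ (kx , ky ∷ []) , inj₁ ft
    tracks u true  true  r     kx fy _  = mk⇔
      (λ { (inj₁ (_ , ky ∷ _) , _) → contradiction fy (Bool.not-¬ ky)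
         ; (inj₂ (fx , _) , _) → contradiction fx (Bool.not-¬ kx) })
      λ ()
    equiv : ∀ p q r → Track (x ∷ y ∷ []) (evalArgs (p ∷ q ∷ r ∷ []) ts) ⇔
            detour ((p ∷ q ∷ r ∷ []) ⊕ (not (lookup a x) ∷ lookup a y ∷ lookup a t ∷ [])) ≡ true
    equiv p q r = subst (λ b → Track (x ∷ y ∷ []) u′ ⇔ detour b ≡ true) (bits-eval p q r)
      (tracks u′ _ _ _ (status-not u′ x) (status u′ y) (status u′ t))
      where u′ = evalArgs (p ∷ q ∷ r ∷ []) ts

-- From a detour to a track.

_∈?_ : ∀ (c : Fin k) L → Dec (c ∈ L)
c ∈? L = Any.any? (c Fin.≟_) L

-- A non-geodesic stretch: the coordinates of L can be flipped one after the other from b to a point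
-- of P while t is flipped, whereas b and all points before the last one fail P while t is not.
data Gap (P : BoolPred k) (t : Fin k) : Vec Bool k → List (Fin k) → Set where
  last : ∀ {b j} → ¬ P b → P (toggle t b) → P (toggle t (toggle j b)) → P (toggle j b) →
         Gap P t b (j ∷ [])
  more : ∀ {b j L} → ¬ P b → P (toggle t b) → Gap P t (toggle j b) L → Gap P t b (j ∷ L)

record Detour (P : BoolPred k) : Set where
  field
    {base}       : Vec Bool k
    {side first} : Fin k
    {others}     : List (Fin k)
    start        : P base
    start-side   : P (toggle side base)
    gap          : Gap P side (toggle first base) others
    unique       : Unique (side ∷ first ∷ others)

module _ {k : ℕ} (a : Vec Bool k) (t : Fin k) where

  -- `Chain` rewritten as a conjunction of 2-clauses on neighbours in the list: no flipped
  -- coordinate directly follows a kept one.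
  Links : List (Fin k) → BoolPred k
  Links []          v = ⊤
  Links (i ∷ [])    v = ⊤
  Links (i ∷ j ∷ L) v = ¬ (lookup v i ≡ lookup a i × lookup v j ≡ not (lookup a j)) × Links (j ∷ L) v

  FE-links : ∀ {S L} → TwoClauses S → Unique L → FE S (Links L)
  FE-links {L = []}        tc _ = FE-⊤
  FE-links {L = _ ∷ []}    tc _ = FE-⊤
  FE-links {L = i ∷ j ∷ L} tc ((i≢j ∷ _) ∷ uniq) =
    FE-∧ (FE-clause₂ tc {s = var i} {var j} i≢j (lookup a i) (not (lookup a j))) (FE-links tc uniq)

  links⇒chain : ∀ L v → Links L v → Chain a t L v
  links⇒chain []       v _ = tt
  links⇒chain (i ∷ []) v _ with same-or-not (lookup v i) (lookup a i)
  ... | inj₁ kept    = inj₁ (kept , [])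
  ... | inj₂ flipped = inj₂ (flipped , tt)
  links⇒chain (i ∷ j ∷ L) v (p , links)
    with same-or-not (lookup v i) (lookup a i) | links⇒chain (j ∷ L) v links
  ... | inj₂ flipped | chain           = inj₂ (flipped , chain)
  ... | inj₁ kept    | inj₁ (kj , ks)  = inj₁ (kept , kj ∷ ks)
  ... | inj₁ kept    | inj₂ (fj , _)   = contradiction (kept , fj) p

  chain⇒links : ∀ L v → Chain a t L v → Links L v
  chain⇒links []          v _ = tt
  chain⇒links (i ∷ [])    v _ = tt
  chain⇒links (i ∷ j ∷ L) v (inj₁ (_ , kj ∷ ks)) =
    (λ (_ , fj) → Bool.not-¬ kj fj) , chain⇒links (j ∷ L) v (inj₁ (kj , ks))
  chain⇒links (i ∷ j ∷ L) v (inj₂ (fi , chain)) =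
    (λ (ki , _) → Bool.not-¬ ki fi) , chain⇒links (j ∷ L) v chain

  module _ (V : List (Fin k)) where

    pin-term : Fin k → Term k
    pin-term c with c ∈? V
    ... | yes _ = var c
    ... | no  _ = const (lookup a c)

    pin-terms : Vec (Term k) k
    pin-terms = tabulate pin-term

    pin : Vec Bool k → Vec Bool k
    pin v = evalArgs v pin-terms

    pin-linear : Linear pin-terms
    pin-linear = linear-inverse pin-terms id inverse
      where
      inverse : ∀ c {x} → lookup pin-terms c ≡ var x → c ≡ x
      inverse c eq with c ∈? V | trans (sym (V.lookup∘tabulate pin-term c)) eq
      ... | yes _ | refl = refl

    pin-∈ : ∀ {c} v → c ∈ V → lookup (pin v) c ≡ lookup v c
    pin-∈ {c} v c∈ rewrite V.lookup-map c (evalTerm v) pin-terms | V.lookup∘tabulate pin-term c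
      with c ∈? V
    ... | yes _  = refl
    ... | no  c∉ = contradiction c∈ c∉

    pin-∉ : ∀ {c} v → ¬ c ∈ V → lookup (pin v) c ≡ lookup a c
    pin-∉ {c} v c∉ rewrite V.lookup-map c (evalTerm v) pin-terms | V.lookup∘tabulate pin-term c
      with c ∈? V
    ... | yes c∈ = contradiction c∈ c∉
    ... | no  _  = refl

  module _ {P : BoolPred k} where

    -- b is the point reached from a along the chain, and u the point that v is pinned to.
    record Reached (b u v : Vec Bool k) (L : List (Fin k)) : Set where
      field
        kept-on   : Agree a t (t ∷ L) b a
        pinned-on : Agree a t (t ∷ L) u v
        off       : ∀ {c} → ¬ c ∈ t ∷ L → lookup u c ≡ lookup b c
    open Reached

    reached-step : ∀ {b u v j L} → All (j ≢_) (t ∷ L) → lookup v j ≡ not (lookup a j) →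
                   Reached b u v (j ∷ L) → Reached (toggle j b) u v L
    reached-step {b} {j = j} {L} j∉ flipped r = record
      { kept-on   = λ c∈ → trans (lookup-toggle′ (≢-sym (All.lookup j∉ c∈)) b) (kept-on r (skip c∈))
      ; pinned-on = λ c∈ → pinned-on r (skip c∈)
      ; off       = off′
      }
      where
      skip : ∀ {c} → c ∈ t ∷ L → c ∈ t ∷ j ∷ L
      skip (here eq)  = here eq
      skip (there c∈) = there (there c∈)
      off′ : ∀ {c} → ¬ c ∈ t ∷ L → _
      off′ {c} c∉ with c Fin.≟ j
      ... | yes refl = trans (pinned-on r (there (here refl))) (trans flipped
              (sym (trans (lookup-toggle j b) (cong not (kept-on r (there (here refl)))))))
      ... | no  c≢j  = trans (off r λ { (here eq) → c∉ (here eq) ; (there (here eq)) → c≢j eq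
                                       ; (there (there c∈)) → c∉ (there c∈) })
                             (sym (lookup-toggle′ c≢j b))

    module _ {b u v : Vec Bool k} {L : List (Fin k)} (r : Reached b u v L) (kept : All (Kept a t v) L) where

      at-base : Kept a t v t → u ≡ b
      at-base kept-t = vec-ext agree
        where
        agree : ∀ c → lookup u c ≡ lookup b c
        agree c with c ∈? (t ∷ L)
        ... | yes c∈ = trans (pinned-on r c∈) (trans (All.lookup (kept-t ∷ kept) c∈) (sym (kept-on r c∈)))
        ... | no  c∉ = off r c∉

      at-side : Flipped a t v t → u ≡ toggle t b
      at-side flipped-t = vec-ext agree
        where
        agree : ∀ c → lookup u c ≡ lookup (toggle t b) c
        agree c with c Fin.≟ t
        ... | yes refl = trans (pinned-on r (here refl)) (trans flipped-t
                (sym (trans (lookup-toggle t b) (cong not (kept-on r (here refl))))))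
        ... | no  c≢t with c ∈? L
        ...   | yes c∈ = trans (pinned-on r (there c∈)) (trans (All.lookup kept c∈)
                  (sym (trans (lookup-toggle′ c≢t b) (kept-on r (there c∈)))))
        ...   | no  c∉ = trans (off r λ { (here eq) → c≢t eq ; (there c∈) → c∉ c∈ })
                               (sym (lookup-toggle′ c≢t b))

    both : ∀ {A B : Set} → A → B → A ⇔ B
    both x y = mk⇔ (λ _ → y) (λ _ → x)

    neither : ∀ {A B : Set} → ¬ A → ¬ B → A ⇔ B
    neither ¬x ¬y = mk⇔ (λ x → contradiction x ¬x) (λ y → contradiction y ¬y)

    -- As long as `v` has the next coordinate flipped, the base moves along the gap. At the first
    -- kept coordinate the chain keeps all the others as well, so `u` is the base or the base with
    -- `t` flipped, and the gap records which of the two satisfy `P`.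
    gap-correct : ∀ {b u v L} → All (t ≢_) L → Unique L → Gap P t b L → Reached b u v L → Chain a t L v →
                  P u ⇔ (Flipped a t v t ⊎ All (Flipped a t v) L)
    gap-correct {v = v} t∉ _ (last ¬Pb Ptb Ptjb Pjb) r chain with same-or-not (lookup v t) (lookup a t) | chain
    ... | inj₁ kt | inj₁ (kj , ks) = neither (¬Pb ∘ subst P (at-base r (kj ∷ ks) kt))
            [ Bool.not-¬ kt , (λ { (fj ∷ _) → Bool.not-¬ kj fj }) ]′
    ... | inj₂ ft | inj₁ (kj , ks) = both (subst P (sym (at-side r (kj ∷ ks) ft)) Ptb) (inj₁ ft)
    gap-correct {v = v} (t≢j ∷ []) _ (last ¬Pb Ptb Ptjb Pjb) r chain | inj₁ kt | inj₂ (fj , _) =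
      both (subst P (sym (at-base (reached-step (≢-sym t≢j ∷ []) fj r) [] kt)) Pjb) (inj₂ (fj ∷ []))
    gap-correct {v = v} (t≢j ∷ []) _ (last ¬Pb Ptb Ptjb Pjb) r chain | inj₂ ft | inj₂ (fj , _) =
      both (subst P (sym (at-side (reached-step (≢-sym t≢j ∷ []) fj r) [] ft)) Ptjb) (inj₁ ft)
    gap-correct {v = v} (t≢j ∷ t∉) (j∉ ∷ uniq) (more ¬Pb Ptb gap) r (inj₂ (fj , chain)) =
      let ih = gap-correct t∉ uniq gap (reached-step (≢-sym t≢j ∷ j∉) fj r) chain
      in mk⇔ ([ inj₁ , inj₂ ∘ (fj ∷_) ]′ ∘ to ih)
             (from ih ∘ [ inj₁ , (λ { (_ ∷ fs) → inj₂ fs }) ]′)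
    gap-correct {v = v} t∉ _ (more ¬Pb Ptb gap) r (inj₁ (kj , ks)) with same-or-not (lookup v t) (lookup a t)
    ... | inj₁ kt = neither (¬Pb ∘ subst P (at-base r (kj ∷ ks) kt))
            [ Bool.not-¬ kt , (λ { (fj ∷ _) → Bool.not-¬ kj fj }) ]′
    ... | inj₂ ft = both (subst P (sym (at-side r (kj ∷ ks) ft)) Ptb) (inj₁ ft)

    -- The links leave only the stages of the chain, and pinning fixes all coordinates off the
    -- detour. With `t` kept, `P` then holds at the first stage, by `P a`, and at the last, by the
    -- end of the gap, but at none between; this is `Ends`.
    FE-gap⇒track : ∀ {S i L} → TwoClauses S → FE S P → P a → P (toggle t a) →
                   Gap P t (toggle i a) L → Unique (t ∷ i ∷ L) → FE S (Track a t (i ∷ L))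
    FE-gap⇒track {S} {i} {L} tc F Pa Pta gap uniq@((t≢i ∷ t∉) ∷ uniq-L@(i∉ ∷ uniq′)) = FE-cong equiv
      (FE-∧ (FE-links tc uniq-L) (FE-subst (pin-terms V) (pin-linear V) F))
      where
      V = t ∷ i ∷ L
      reached : ∀ v → Reached a (pin V v) v (i ∷ L)
      reached v = record { kept-on = λ _ → refl ; pinned-on = pin-∈ V v ; off = pin-∉ V v }
      on-track : ∀ v → Chain a t (i ∷ L) v → P (pin V v) ⇔ (Flipped a t v t ⊎ Ends a t (i ∷ L) v)
      on-track v (inj₂ (fi , chain)) =
        let ih = gap-correct t∉ uniq′ gap (reached-step (≢-sym t≢i ∷ i∉) fi (reached v)) chain
        in mk⇔ ([ inj₁ , inj₂ ∘ inj₂ ∘ (fi ∷_) ]′ ∘ to ih)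
               (from ih ∘ [ inj₁ , [ (λ { (ki ∷ _) → contradiction fi (Bool.not-¬ ki) })
                                   , (λ { (_ ∷ fs) → inj₂ fs }) ]′ ]′)
      on-track v (inj₁ (ki , ks)) with same-or-not (lookup v t) (lookup a t)
      ... | inj₁ kt = both (subst P (sym (at-base (reached v) (ki ∷ ks) kt)) Pa) (inj₂ (inj₁ (ki ∷ ks)))
      ... | inj₂ ft = both (subst P (sym (at-side (reached v) (ki ∷ ks) ft)) Pta) (inj₁ ft)
      equiv : ∀ v → (Links (i ∷ L) v × P (pin V v)) ⇔ Track a t (i ∷ L) v
      equiv v = mk⇔
        (λ (links , Pu) → let chain = links⇒chain (i ∷ L) v links in chain , to (on-track v chain) Pu)
        (λ (chain , e) → chain⇒links (i ∷ L) v chain , from (on-track v chain) e)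

detour⇒three-clauses : ∀ {S k} {P : BoolPred k} → TwoClauses S → FE S P → Detour P → ThreeClauses S
detour⇒three-clauses tc F record { base = a ; side = t ; start = Pa ; start-side = Pta ; gap = gap ; unique = uniq } =
  on-list gap uniq (FE-gap⇒track a t tc F Pa Pta gap uniq)
  where
  on-list : ∀ {i L} → Gap _ t (toggle i a) L → Unique (t ∷ i ∷ L) → FE _ (Track a t (i ∷ L)) → ThreeClauses _
  -- A gap has at least one coordinate, so the list has the two that `FE-track` requires.
  on-list {L = j ∷ L} _ uniq F =
    let (x , y , x≢y , t≢x , t≢y , F′) = FE-track a t uniq F
    in three-clauses tc _ (FE-track⇒detour a t x≢y t≢x t≢y F′)

-- Geodesics

-- Each step flips a coordinate where the current point still differs from the target, so the length
-- is the Hamming distance.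
data Geodesic (P : BoolPred k) : Vec Bool k → Vec Bool k → Set where
  done : ∀ {b} → P b → Geodesic P b b
  step : ∀ {a b i} → P a → lookup a i ≢ lookup b i → Geodesic P (toggle i a) b → Geodesic P a b

geodesic-source : Geodesic P a b → P a
geodesic-source (done Pb)     = Pb
geodesic-source (step Pa _ _) = Pa

geodesic⇒path : Geodesic P a b → Path P a b
geodesic⇒path (done Pb)             = here Pb
geodesic⇒path (step {i = i} Pa _ g) = step Pa (i , refl) (geodesic⇒path g)

toggle-≢ : ∀ (i : Fin k) a b → lookup a i ≢ lookup b i → lookup (toggle i a) i ≡ lookup b i
toggle-≢ i a b a≢b = trans (lookup-toggle i a) (sym (Bool.¬-not (≢-sym a≢b)))

geodesic-keeps : ∀ {a b} l → Geodesic P a b → lookup a l ≡ lookup b l →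
                 Path (λ v → P v × lookup v l ≡ lookup b l) a b
geodesic-keeps l (done Pb)                 eq = here (Pb , refl)
geodesic-keeps l (step {a} {i = i} Pa a≢b g) eq = step (Pa , eq) (i , refl)
  (geodesic-keeps l g (trans (lookup-toggle′ (λ { refl → a≢b eq }) a) eq))

module _ {k : ℕ} {P : BoolPred k} (P? : ∀ v → Dec (P v)) where

  -- Follow the geodesic and watch the parallel point with `t` flipped back. The geodesic must flip
  -- `t` back at some time, and the parallel point then lies in `P`; so it enters `P` at some
  -- earlier flip, and the first such flip ends the gap.
  find-gap : ∀ {t c b} → ¬ P c → Geodesic P (toggle t c) b → lookup c t ≡ lookup b t →
             Σ (List (Fin k)) λ L → Gap P t c L × Unique L × All (λ l → lookup c l ≢ lookup b l) L
  find-gap {t} {c} ¬Pc g c≡b = go _ refl ¬Pc g c≡b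
    where
    go : ∀ {t c b} x → x ≡ toggle t c → ¬ P c → Geodesic P x b → lookup c t ≡ lookup b t →
         Σ (List (Fin k)) λ L → Gap P t c L × Unique L × All (λ l → lookup c l ≢ lookup b l) L
    go {t} {c} _ refl ¬Pc (done _) c≡b = contradiction (lookup-toggle t c) (Bool.not-¬ (sym c≡b))
    go {t} {c} {b} _ refl ¬Pc (step {i = j} Px x≢b g) c≡b with j Fin.≟ t
    ... | yes refl = contradiction (subst P (toggle-involutive t c) (geodesic-source g)) ¬Pc
    ... | no  j≢t  with P? (toggle j c)
    ...   | yes Pj = j ∷ [] , last ¬Pc Px (subst P (toggle-comm j≢t c) (geodesic-source g)) Pj ,
                     [] ∷ [] , (x≢b ∘ trans (lookup-toggle′ j≢t c)) ∷ []
    ...   | no ¬Pj =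
      let (L , gap , uniq , differ) = go _ (toggle-comm j≢t c) ¬Pj g
                                         (trans (lookup-toggle′ (≢-sym j≢t) c) c≡b)
          -- A geodesic repeats no coordinate: after the flip it agrees with `b` at `j`, whereas the
          -- later coordinates still differ.
          j∉L = All.map (λ { l≢ refl → l≢ (toggle-≢ j c b c≢b) }) differ
      in j ∷ L , more ¬Pc Px gap , j∉L ∷ uniq ,
         c≢b ∷ All.zipWith (λ (j≢l , l≢) → l≢ ∘ trans (lookup-toggle′ (≢-sym j≢l) c)) (j∉L , differ)
      where
      c≢b : lookup c j ≢ lookup b j
      c≢b = x≢b ∘ trans (lookup-toggle′ j≢t c)

  -- Copy the geodesic with `t` flipped back. If the copy stays in `P` until the original flips `t`,
  -- the two merge and the copy is a geodesic. Otherwise the last copied point in `P` is the base of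
  -- a detour.
  shortcut : ∀ {t a b} x → x ≡ toggle t a → P a → Geodesic P x b → lookup a t ≡ lookup b t →
             Detour P ⊎ Geodesic P a b
  shortcut {t} {a} _ refl Pa (done _) a≡b = contradiction (lookup-toggle t a) (Bool.not-¬ (sym a≡b))
  shortcut {t} {a} {b} _ refl Pa (step {i = i} Px x≢b g) a≡b with i Fin.≟ t
  ... | yes refl = inj₂ (subst (λ v → Geodesic P v b) (toggle-involutive t a) g)
  ... | no  i≢t  with P? (toggle i a)
  ...   | yes Pi = [ inj₁ , inj₂ ∘ step Pa a≢b ]′ (shortcut _ (toggle-comm i≢t a) Pi g keeps-t)
    where
    a≢b : lookup a i ≢ lookup b i
    a≢b = x≢b ∘ trans (lookup-toggle′ i≢t a)
    keeps-t : lookup (toggle i a) t ≡ lookup b t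
    keeps-t = trans (lookup-toggle′ (≢-sym i≢t) a) a≡b
  ...   | no ¬Pi =
    let (L , gap , uniq , differ) = find-gap ¬Pi (subst (λ v → Geodesic P v b) (toggle-comm i≢t a) g) keeps-t
    in inj₁ record
      { start = Pa ; start-side = Px ; gap = gap
      ; unique = (≢-sym i≢t ∷ All.map (λ { l≢ refl → l≢ keeps-t }) differ) ∷
                 All.map (λ { l≢ refl → l≢ (toggle-≢ i a b a≢b) }) differ ∷ uniq }
    where
    a≢b : lookup a i ≢ lookup b i
    a≢b = x≢b ∘ trans (lookup-toggle′ i≢t a)
    keeps-t : lookup (toggle i a) t ≡ lookup b t
    keeps-t = trans (lookup-toggle′ (≢-sym i≢t) a) a≡b

  geodesic-cons : ∀ {a b} i → P a → Geodesic P (toggle i a) b → Detour P ⊎ Geodesic P a b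
  geodesic-cons {a} {b} i Pa g with lookup a i Bool.≟ lookup b i
  ... | no  a≢b = inj₂ (step Pa a≢b g)
  ... | yes a≡b = shortcut _ refl Pa g a≡b

-- Deciding geodesics, and isometric predicates.

⟦_⟧ : ∀ {A : Fin k → Set} → (∀ i → Dec (A i)) → Subset k
⟦ A? ⟧ = tabulate (does ∘ A?)

-- Strict inclusion of such sets is the measure of both well-founded recursions below: the search
-- for geodesics and the majority argument.
⟦⟧-⊂ : ∀ {A B : Fin k → Set} (A? : ∀ i → Dec (A i)) (B? : ∀ i → Dec (B i)) →
       (∀ i → A i → B i) → ∀ i → ¬ A i → B i → ⟦ A? ⟧ ⊂ ⟦ B? ⟧
⟦⟧-⊂ A? B? A⊆B i ¬Ai Bi =
  (λ {j} j∈ → ∈⁺ B? j (A⊆B j (∈⁻ A? j j∈))) , i , ∈⁺ B? i Bi , (¬Ai ∘ ∈⁻ A? i)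
  where
  ∈⁺ : ∀ {A : Fin _ → Set} (A? : ∀ i → Dec (A i)) i → A i → i Subset.∈ ⟦ A? ⟧
  ∈⁺ A? i Ai = V.lookup⇒[]= i _ (trans (V.lookup∘tabulate _ i) (dec-true (A? i) Ai))
  ∈⁻ : ∀ {A : Fin _ → Set} (A? : ∀ i → Dec (A i)) i → i Subset.∈ ⟦ A? ⟧ → A i
  ∈⁻ A? i i∈ with A? i | trans (sym (V.lookup∘tabulate (does ∘ A?) i)) (V.[]=⇒lookup i∈)
  ... | yes Ai | _ = Ai

differ? : ∀ (a b : Vec Bool k) i → Dec (lookup a i ≢ lookup b i)
differ? a b i = ¬? (lookup a i Bool.≟ lookup b i)

toggle-closer : ∀ (a b : Vec Bool k) i → lookup a i ≢ lookup b i →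
                ⟦ differ? (toggle i a) b ⟧ ⊂ ⟦ differ? a b ⟧
toggle-closer a b i a≢b =
  ⟦⟧-⊂ (differ? (toggle i a) b) (differ? a b) subset i (λ ne → ne (toggle-≢ i a b a≢b)) a≢b
  where
  subset : ∀ j → lookup (toggle i a) j ≢ lookup b j → lookup a j ≢ lookup b j
  subset j ne with j Fin.≟ i
  ... | yes refl = a≢b
  ... | no  j≢i  = ne ∘ trans (lookup-toggle′ j≢i a)

geodesic? : (∀ v → Dec (P v)) → ∀ a b → Dec (Geodesic P a b)
geodesic? {P = P} P? a b = go a (⊂-wellFounded _)
  where
  go : ∀ a → Acc _⊂_ ⟦ differ? a b ⟧ → Dec (Geodesic P a b)
  go a (acc rec) with V.≡-dec Bool._≟_ a b | P? a
  ... | _        | no ¬Pa = no (¬Pa ∘ geodesic-source)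
  ... | yes refl | yes Pa = yes (done Pa)
  ... | no  a≢b  | yes Pa with Fin.any? closer?
    where
    closer? : ∀ i → Dec (lookup a i ≢ lookup b i × Geodesic P (toggle i a) b)
    closer? i with differ? a b i
    ... | no  a≡b = no (a≡b ∘ proj₁)
    ... | yes a≢b = map′ (a≢b ,_) proj₂ (go (toggle i a) (rec (toggle-closer a b i a≢b)))
  ... | yes (i , a≢b , g) = yes (step Pa a≢b g)
  ... | no  ∄             = no λ { (done _) → a≢b refl ; (step _ ne g) → ∄ (_ , ne , g) }

-- Absorbing one step in front of a geodesic is enough to turn every path into a geodesic, so each
-- component is an isometric subgraph of the hypercube.
Isometric : BoolPred k → Set
Isometric P = ∀ a i b → P a → Geodesic P (toggle i a) b → Geodesic P a b

path⇒geodesic : Isometric P → Path P a b → Geodesic P a b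
path⇒geodesic iso (here Pa)               = done Pa
path⇒geodesic iso (step Pa (i , refl) p) = iso _ i _ Pa (path⇒geodesic iso p)

-- Finite search as a constructive case distinction: the first alternative is an instance that
-- succeeds, the second that all instances fail in the way `A` describes.
⊎-∀Fin : ∀ {X : Set} n {A : Fin n → Set} → (∀ i → X ⊎ A i) → X ⊎ (∀ i → A i)
⊎-∀Fin zero    f = inj₂ λ ()
⊎-∀Fin (suc n) f with f zero | ⊎-∀Fin n (f ∘ suc)
... | inj₁ x | _      = inj₁ x
... | inj₂ _ | inj₁ x = inj₁ x
... | inj₂ p | inj₂ q = inj₂ λ { zero → p ; (suc i) → q i }

⊎-∀Bool : ∀ {X : Set} {A : Bool → Set} → (∀ b → X ⊎ A b) → X ⊎ (∀ b → A b)
⊎-∀Bool f with f false | f true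
... | inj₁ x | _      = inj₁ x
... | inj₂ _ | inj₁ x = inj₁ x
... | inj₂ p | inj₂ q = inj₂ λ { false → p ; true → q }

⊎-∀Vec : ∀ {X : Set} k {A : Vec Bool k → Set} → (∀ v → X ⊎ A v) → X ⊎ (∀ v → A v)
⊎-∀Vec zero    f = [ inj₁ , (λ p → inj₂ λ { [] → p }) ]′ (f [])
⊎-∀Vec (suc k) f = [ inj₁ , (λ p → inj₂ λ { (b ∷ v) → p b v }) ]′
  (⊎-∀Bool λ b → ⊎-∀Vec k (f ∘ (b ∷_)))

detour-or-isometric : ∀ {X : Set} → (∀ v → Dec (P v)) → (Detour P → X) → X ⊎ Isometric P
detour-or-isometric {k} {P} {X = X} P? detour⇒X = ⊎-∀Vec k λ a → ⊎-∀Fin k λ i → ⊎-∀Vec k λ b → decide a i b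
  where
  decide : ∀ a i b → X ⊎ (P a → Geodesic P (toggle i a) b → Geodesic P a b)
  decide a i b with P? a | geodesic? P? (toggle i a) b
  ... | no ¬Pa | _     = inj₂ λ Pa _ → contradiction Pa ¬Pa
  ... | yes _  | no ¬g = inj₂ λ _ g → contradiction g ¬g
  ... | yes Pa | yes g = [ inj₁ ∘ detour⇒X , (λ g′ → inj₂ λ _ _ → g′) ]′ (geodesic-cons P? i Pa g)

-- Majority

majority : Bool → Bool → Bool → Bool
majority false y z = y ∧ z
majority true  y z = y ∨ z

majority₁₂ : ∀ {x y} z → x ≡ y → majority x y z ≡ x
majority₁₂ {false} z refl = refl
majority₁₂ {true}  z refl = refl

majority₁₃ : ∀ {x z} y → x ≡ z → majority x y z ≡ x
majority₁₃ {false} y refl = Bool.∧-zeroʳ y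
majority₁₃ {true}  y refl = Bool.∨-zeroʳ y

majority₂₃ : ∀ x {y z} → y ≡ z → majority x y z ≡ y
majority₂₃ false refl = Bool.∧-idem _
majority₂₃ true  refl = Bool.∨-idem _

≢-≢⇒≡ : ∀ {x y z : Bool} → x ≢ y → y ≢ z → x ≡ z
≢-≢⇒≡ x≢y y≢z = trans (Bool.¬-not x≢y) (sym (Bool.¬-not (≢-sym y≢z)))

maj : Vec Bool k → Vec Bool k → Vec Bool k → Vec Bool k
maj a b c = tabulate λ i → majority (lookup a i) (lookup b i) (lookup c i)

lookup-maj : ∀ (a b c : Vec Bool k) i → lookup (maj a b c) i ≡ majority (lookup a i) (lookup b i) (lookup c i)
lookup-maj a b c = V.lookup∘tabulate _

MajorityClosed : BoolPred k → Set
MajorityClosed P = ∀ a b c → P a → P b → P c → P (maj a b c)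

Avoid : Fin k → Bool → Fin k → Bool → BoolPred k → BoolPred k
Avoid i α j β P v = P v × ¬ (lookup v i ≡ α × lookup v j ≡ β)

NotAllEqual : (a b c : Vec Bool k) → Fin k → Set
NotAllEqual a b c i = ¬ (lookup a i ≡ lookup b i × lookup a i ≡ lookup c i)

notAllEqual? : ∀ (a b c : Vec Bool k) i → Dec (NotAllEqual a b c i)
notAllEqual? a b c i = ¬? ((lookup a i Bool.≟ lookup b i) ×-dec (lookup a i Bool.≟ lookup c i))

odd-one-out? : ∀ (a b c : Vec Bool k) i → Dec (lookup a i ≢ lookup b i × lookup b i ≡ lookup c i)
odd-one-out? a b c i = differ? a b i ×-dec (lookup b i Bool.≟ lookup c i)

module _ {k : ℕ} {P : BoolPred k} (iso : Isometric P)
         (iso-avoid : ∀ i α j β → i ≢ j → Isometric (Avoid i α j β P)) where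

  module _ {a b c : Vec Bool k} {i j : Fin k}
           (a≢b-i : lookup a i ≢ lookup b i) (b≡c-i : lookup b i ≡ lookup c i)
           (b≢a-j : lookup b j ≢ lookup a j) (a≡c-j : lookup a j ≡ lookup c j) where

    i≢j : i ≢ j
    i≢j refl = b≢a-j (trans b≡c-i (sym a≡c-j))

    -- The walk through c avoids the excluded corner: it keeps j on the way to c, and i from there on.
    avoiding-geodesic : Path P a b → Path P a c → Geodesic (Avoid i (lookup a i) j (lookup b j) P) a b
    avoiding-geodesic ab ac = path⇒geodesic (iso-avoid i _ j _ i≢j) (path-trans
      (path-mono (λ (Pv , v≡c) → Pv , λ (_ , v≡b) → b≢a-j (trans (sym v≡b) (trans v≡c (sym a≡c-j))))
        (geodesic-keeps j (path⇒geodesic iso ac) a≡c-j))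
      (path-sym
        (path-mono (λ (Pv , v≡c) → Pv , λ (v≡a , _) → a≢b-i (trans (sym v≡a) (trans v≡c (sym b≡c-i))))
          (geodesic-keeps i (path⇒geodesic iso (path-trans (path-sym ab) ac)) b≡c-i))))

    -- Chosen so that `maj a point c` is `a` with `coord` flipped: `point` agrees with `c` at
    -- `coord`, and elsewhere `a` agrees with `point` or `c`. By `at-j` the triple with `point` in
    -- place of `b` is all equal at `j`, so the induction applies to it.
    record Switch : Set where
      field
        point   : Vec Bool k
        coord   : Fin k
        path    : Path P a point
        a≢b     : lookup a coord ≢ lookup b coord
        b≡c     : lookup b coord ≡ lookup c coord
        at      : lookup point coord ≡ lookup b coord
        at-j    : lookup point j ≡ lookup a j
        near    : ∀ l → l ≢ coord → lookup point l ≡ lookup a l ⊎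
                    (lookup point l ≡ lookup b l × lookup a l ≡ lookup c l)

    -- The point reached when a coordinate where a is the odd one out is toggled for the first time.
    first-switch : ∀ {x} → Geodesic (Avoid i (lookup a i) j (lookup b j) P) x b → Path P a x →
                   lookup x j ≡ lookup a j →
                   (∀ l → lookup x l ≡ lookup a l ⊎ (lookup x l ≡ lookup b l × lookup a l ≡ lookup c l)) →
                   Switch
    first-switch (done _) _ _ near with near i
    ... | inj₁ b≡a       = contradiction (sym b≡a) a≢b-i
    ... | inj₂ (_ , a≡c) = contradiction (trans a≡c (sym b≡c-i)) a≢b-i
    first-switch {x} (step {i = l} (Px , _) x≢b g) ax at-j near = by-cases (near l) (lookup b l Bool.≟ lookup c l)
      where
      ax′ : Path P a (toggle l x)
      ax′ = path-trans ax (step Px (l , refl) (here (proj₁ (geodesic-source g))))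
      by-cases : lookup x l ≡ lookup a l ⊎ (lookup x l ≡ lookup b l × lookup a l ≡ lookup c l) →
                 Dec (lookup b l ≡ lookup c l) → Switch
      by-cases (inj₂ (x≡b , _)) _ = contradiction x≡b x≢b
      by-cases (inj₁ x≡a) (yes b≡c) = record
        { point = toggle l x ; coord = l ; path = ax′ ; a≢b = x≢b ∘ trans x≡a ; b≡c = b≡c
        ; at = toggle-≢ l x b x≢b
        ; at-j = trans (lookup-toggle′ (λ { refl → b≢a-j (trans b≡c (sym a≡c-j)) }) x) at-j
        ; near = λ l′ l′≢l → [ inj₁ ∘ trans (lookup-toggle′ l′≢l x)
                             , (λ (e , e′) → inj₂ (trans (lookup-toggle′ l′≢l x) e , e′)) ]′ (near l′) }
      by-cases (inj₁ x≡a) (no b≢c) with l Fin.≟ j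
      -- Flipping `j` now would give the excluded corner, since `i` still has its value in `a`.
      ... | yes refl = contradiction (at-i (near i) , toggle-≢ l x b x≢b) (proj₂ (geodesic-source g))
        where
        at-i : lookup x i ≡ lookup a i ⊎ (lookup x i ≡ lookup b i × lookup a i ≡ lookup c i) →
               lookup (toggle j x) i ≡ lookup a i
        at-i (inj₁ eq)        = trans (lookup-toggle′ i≢j x) eq
        at-i (inj₂ (_ , a≡c)) = contradiction (trans a≡c (sym b≡c-i)) a≢b-i
      ... | no l≢j = first-switch g ax′ (trans (lookup-toggle′ (≢-sym l≢j) x) at-j) near′
        where
        near′ : ∀ l′ → lookup (toggle l x) l′ ≡ lookup a l′ ⊎
                       (lookup (toggle l x) l′ ≡ lookup b l′ × lookup a l′ ≡ lookup c l′)
        near′ l′ with l′ Fin.≟ l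
        ... | yes refl = inj₂ (toggle-≢ l x b x≢b , ≢-≢⇒≡ (x≢b ∘ trans x≡a) b≢c)
        ... | no  l′≢l = [ inj₁ ∘ trans (lookup-toggle′ l′≢l x)
                         , (λ (e , e′) → inj₂ (trans (lookup-toggle′ l′≢l x) e , e′)) ]′ (near l′)

    switch : Path P a b → Path P a c → Switch
    switch ab ac = first-switch (avoiding-geodesic ab ac) (here (path-source ab)) refl (λ _ → inj₁ refl)

  -- If `a` is nowhere the odd one out, the majority is `a`; likewise for `b`. Otherwise the switch
  -- gives a smaller triple whose majority is `a′`, a neighbour of `a`. Replacing `a` by `a′` leaves
  -- the majority unchanged and makes the three points equal at one more coordinate.
  path-maj : ∀ a b c → Acc _⊂_ ⟦ notAllEqual? a b c ⟧ → Path P a b → Path P a c → Path P a (maj a b c)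
  path-maj a b c (acc rec) ab ac with Fin.any? (odd-one-out? a b c) | Fin.any? (odd-one-out? b a c)
  ... | no ∄ | _ = subst (Path P a) (vec-ext agree) (here (path-source ab))
    where
    agree : ∀ i → lookup a i ≡ lookup (maj a b c) i
    agree i = sym (trans (lookup-maj a b c i) (at-i (lookup a i Bool.≟ lookup b i)))
      where
      at-i : Dec (lookup a i ≡ lookup b i) → _
      at-i (yes a≡b) = majority₁₂ (lookup c i) a≡b
      at-i (no a≢b)  = majority₁₃ (lookup b i) (≢-≢⇒≡ a≢b λ b≡c → ∄ (i , a≢b , b≡c))
  ... | yes _ | no ∄ = subst (Path P a) (vec-ext agree) ab
    where
    agree : ∀ i → lookup b i ≡ lookup (maj a b c) i
    agree i = sym (trans (lookup-maj a b c i) (at-i (lookup b i Bool.≟ lookup a i)))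
      where
      at-i : Dec (lookup b i ≡ lookup a i) → _
      at-i (yes b≡a) = trans (majority₁₂ (lookup c i) (sym b≡a)) (sym b≡a)
      at-i (no b≢a)  = majority₂₃ (lookup a i) (≢-≢⇒≡ b≢a λ a≡c → ∄ (i , b≢a , a≡c))
  ... | yes (i , a≢b-i , b≡c-i) | yes (j , b≢a-j , a≡c-j) =
    path-trans to-a′ (subst (Path P a′) maj-a′bc
      (path-maj a′ b c (rec closer-a′) (path-trans (path-sym to-a′) ab) (path-trans (path-sym to-a′) ac)))
    where
    open Switch (switch a≢b-i b≡c-i b≢a-j a≡c-j ab ac)
    x = point
    s = coord
    a′ = toggle s a
    at-a′ : lookup a′ s ≡ lookup b s
    at-a′ = toggle-≢ s a b a≢b
    closer-x : ⟦ notAllEqual? a x c ⟧ ⊂ ⟦ notAllEqual? a b c ⟧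
    closer-x = ⟦⟧-⊂ (notAllEqual? a x c) (notAllEqual? a b c) subset j
      (λ ne → ne (sym at-j , a≡c-j)) (λ (a≡b , _) → b≢a-j (sym a≡b))
      where
      subset : ∀ l → NotAllEqual a x c l → NotAllEqual a b c l
      subset l ne (a≡b , a≡c) with l Fin.≟ s
      ... | yes refl = a≢b a≡b
      ... | no  l≢s  = ne (sym ([ id , (λ (x≡b , _) → trans x≡b (sym a≡b)) ]′ (near l l≢s)) , a≡c)
    maj-axc : maj a x c ≡ a′
    maj-axc = vec-ext agree
      where
      agree : ∀ l → lookup (maj a x c) l ≡ lookup a′ l
      agree l with l Fin.≟ s
      ... | yes refl = trans (lookup-maj a x c s)
              (trans (majority₂₃ (lookup a s) (trans at b≡c)) (trans at (sym at-a′)))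
      ... | no  l≢s  = trans (lookup-maj a x c l) (trans
              ([ majority₁₂ (lookup c l) ∘ sym , majority₁₃ (lookup x l) ∘ proj₂ ]′ (near l l≢s))
              (sym (lookup-toggle′ l≢s a)))
    to-a′ : Path P a a′
    to-a′ = subst (Path P a) maj-axc (path-maj a x c (rec closer-x) path ac)
    closer-a′ : ⟦ notAllEqual? a′ b c ⟧ ⊂ ⟦ notAllEqual? a b c ⟧
    closer-a′ = ⟦⟧-⊂ (notAllEqual? a′ b c) (notAllEqual? a b c) subset s
      (λ ne → ne (at-a′ , trans at-a′ b≡c)) (a≢b ∘ proj₁)
      where
      subset : ∀ l → NotAllEqual a′ b c l → NotAllEqual a b c l
      subset l ne (a≡b , a≡c) with l Fin.≟ s
      ... | yes refl = a≢b a≡b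
      ... | no  l≢s  = ne (trans (lookup-toggle′ l≢s a) a≡b , trans (lookup-toggle′ l≢s a) a≡c)
    maj-a′bc : maj a′ b c ≡ maj a b c
    maj-a′bc = vec-ext agree
      where
      agree : ∀ l → lookup (maj a′ b c) l ≡ lookup (maj a b c) l
      agree l rewrite lookup-maj a′ b c l | lookup-maj a b c l with l Fin.≟ s
      ... | yes refl = trans (majority₂₃ (lookup a′ s) b≡c) (sym (majority₂₃ (lookup a s) b≡c))
      ... | no  l≢s  = cong (λ y → majority y (lookup b l) (lookup c l)) (lookup-toggle′ l≢s a)

  component-majority-closed : ∀ v → MajorityClosed (Path P v)
  component-majority-closed v a b c va vb vc = path-trans va
    (path-maj a b c (⊂-wellFounded _) (path-trans (path-sym va) vb) (path-trans (path-sym va) vc))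

-- Majority-closed predicates are determined by their projections to pairs of coordinates.
module _ {k : ℕ} {P : BoolPred k} (P? : ∀ v → Dec (P v)) (closed : MajorityClosed P) where

  Extends : Literal k → Literal k → Set
  Extends (i , α) (j , β) = ∃[ u ] (P u × lookup u i ≡ α × lookup u j ≡ β)

  extends? : ∀ l m → Dec (Extends l m)
  extends? (i , α) (j , β) =
    -- `Subset k` is `Vec Bool k`, so this searches all points.
    anySubset? λ u → P? u ×-dec (lookup u i Bool.≟ α) ×-dec (lookup u j Bool.≟ β)

  refute : Literal k × Literal k → Clause2 k
  refute ((i , α) , (j , β)) = (i , not α) ∷ (j , not β) ∷ [] , s≤s (s≤s z≤n)

  literals : List (Literal k)
  literals = L.cartesianProduct (L.allFin k) (false ∷ true ∷ [])

  ∈-literals : ∀ i α → (i , α) ∈ literals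
  ∈-literals i α = ∈-cartesianProduct⁺ (∈-allFin i) (bool α)
    where
    bool : ∀ α → α ∈ false ∷ true ∷ []
    bool false = here refl
    bool true  = there (here refl)

  excluded? : ∀ (p : Literal k × Literal k) → Dec (¬ Extends (proj₁ p) (proj₂ p))
  excluded? (l , m) = ¬? (extends? l m)

  -- One clause for each pair of literals that no point of `P` satisfies jointly. Both literals may
  -- lie on the same coordinate, which accounts for single coordinates.
  projections : TwoCNF k
  projections = L.map refute (L.filter excluded? (L.cartesianProduct literals literals))

  eval-refute : ∀ (v : Vec Bool k) i α → evalLit v (i , not α) ≡ true ⇔ lookup v i ≢ α
  eval-refute v i true  = mk⇔ (λ e e′ → Bool.not-¬ refl (trans e′ (sym e))) (cong not ∘ Bool.¬-not)
  eval-refute v i false = mk⇔ (λ e e′ → contradiction (trans (sym e) e′) λ ()) Bool.¬-not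

  projections-sound : ∀ {v} → P v → sat2CNF projections v
  projections-sound {v} Pv = All.map⁺ (All.map (λ {p} → sat p)
    (All.all-filter excluded? (L.cartesianProduct literals literals)))
    where
    sat : ∀ p → ¬ Extends (proj₁ p) (proj₂ p) → sat2Clause v (refute p)
    sat ((i , α) , (j , β)) ne with lookup v i Bool.≟ α | lookup v j Bool.≟ β
    ... | no v≢α  | _       = here (from (eval-refute v i α) v≢α)
    ... | yes _   | no v≢β  = there (here (from (eval-refute v j β) v≢β))
    ... | yes v≡α | yes v≡β = contradiction (v , Pv , v≡α , v≡β) ne

  agree-on-pair : ∀ {v} → sat2CNF projections v → ∀ i j → Extends (i , lookup v i) (j , lookup v j)
  agree-on-pair {v} sat i j with extends? (i , lookup v i) (j , lookup v j)
  ... | yes ext = ext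
  ... | no ¬ext with All.lookup sat (∈-map⁺ refute (∈-filter⁺ excluded?
                       (∈-cartesianProduct⁺ (∈-literals i (lookup v i)) (∈-literals j (lookup v j))) ¬ext))
  ...   | here e         = contradiction refl (to (eval-refute v i _) e)
  ...   | there (here e) = contradiction refl (to (eval-refute v j _) e)

  AgreeOn : Vec Bool k → List (Fin k) → Set
  AgreeOn v L = ∃[ u ] (P u × All (λ i → lookup u i ≡ lookup v i) L)

  -- The Baker-Pixley argument: three points of `P` agree with `v` on the list without its first,
  -- second or third coordinate. At each coordinate at least two of them agree with `v`, hence so
  -- does their majority. The bound `n` on the length is the recursion argument, and `u₀` serves the
  -- empty list.
  agree-on : ∀ {v u₀} → P u₀ → sat2CNF projections v → ∀ n L → length L ≤ n → AgreeOn v L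
  agree-on {u₀ = u₀} Pu₀ sat n [] _ = u₀ , Pu₀ , []
  agree-on Pu₀ sat n (i ∷ []) _ with agree-on-pair sat i i
  ... | u , Pu , e , _ = u , Pu , e ∷ []
  agree-on Pu₀ sat n (i ∷ j ∷ []) _ with agree-on-pair sat i j
  ... | u , Pu , e , e′ = u , Pu , e ∷ e′ ∷ []
  agree-on {v} Pu₀ sat (suc n) (i ∷ j ∷ l ∷ L) (s≤s len)
    with agree-on Pu₀ sat n (j ∷ l ∷ L) len | agree-on Pu₀ sat n (i ∷ l ∷ L) len | agree-on Pu₀ sat n (i ∷ j ∷ L) len
  ... | u₁ , P₁ , j₁ ∷ l₁ ∷ e₁ | u₂ , P₂ , i₂ ∷ l₂ ∷ e₂ | u₃ , P₃ , i₃ ∷ j₃ ∷ e₃ =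
    maj u₁ u₂ u₃ , closed u₁ u₂ u₃ P₁ P₂ P₃ ,
    two i (trans (majority₂₃ (lookup u₁ i) (trans i₂ (sym i₃))) i₂) ∷
    two j (trans (majority₁₃ (lookup u₂ j) (trans j₁ (sym j₃))) j₁) ∷
    two l (trans (majority₁₂ (lookup u₃ l) (trans l₁ (sym l₂))) l₁) ∷
    All.zipWith (λ {c} (p , q) → two c (trans (majority₁₂ (lookup u₃ c) (trans p (sym q))) p)) (e₁ , e₂)
    where
    two : ∀ c → majority (lookup u₁ c) (lookup u₂ c) (lookup u₃ c) ≡ lookup v c →
          lookup (maj u₁ u₂ u₃) c ≡ lookup v c
    two c = trans (lookup-maj u₁ u₂ u₃ c)

  majority-closed⇒bijunctive : ∀ {u₀} → P u₀ → Bijunctive P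
  majority-closed⇒bijunctive Pu₀ = projections , λ v → projections-sound , λ sat →
    let (u , Pu , eq) = agree-on Pu₀ sat _ (L.allFin k) ≤-refl
    in subst P (vec-ext λ i → All.lookup eq (∈-allFin i)) Pu

-- Non-tight sets

FE-rel : ∀ S (i : Fin (length S)) → FE S (λ v → rel (L.lookup S i) v ≡ true)
FE-rel S i = FE-cong
  (λ v → mk⇔ (subst (λ w → rel (L.lookup S i) w ≡ true) (eval v))
             (subst (λ w → rel (L.lookup S i) w ≡ true) (sym (eval v))))
  (FE-atom S i (tabulate var))
  where
  eval : ∀ v → evalArgs v (tabulate var) ≡ v
  eval v = trans (evalArgs-tabulate v var) (V.tabulate∘lookup v)

-- As 2-clauses are expressible, so are the restrictions of the relation by them, and a detour in a
-- restriction is as good as one in the relation itself.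
three-clauses-or-componentwise-bijunctive :
  ∀ S (i : Fin (length S)) → TwoClauses S → ThreeClauses S ⊎ ComponentwiseBijunctive (L.lookup S i)
three-clauses-or-componentwise-bijunctive S idx tc = decide isometric isometric-avoid
  where
  R = L.lookup S idx
  Holds : BoolPred (arity R)
  Holds v = rel R v ≡ true
  holds? : ∀ v → Dec (Holds v)
  holds? v = rel R v Bool.≟ true
  Iso-avoid : Set
  Iso-avoid = ∀ i α j β → i ≢ j → Isometric (Avoid i α j β Holds)
  isometric : ThreeClauses S ⊎ Isometric Holds
  isometric = detour-or-isometric holds? (detour⇒three-clauses tc (FE-rel S idx))
  isometric-avoid : ThreeClauses S ⊎ Iso-avoid
  isometric-avoid = ⊎-∀Fin _ λ i → ⊎-∀Bool λ α → ⊎-∀Fin _ λ j → ⊎-∀Bool λ β → avoid i α j β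
    where
    avoid : ∀ i α j β → ThreeClauses S ⊎ (i ≢ j → Isometric (Avoid i α j β Holds))
    avoid i α j β with i Fin.≟ j
    ... | yes i≡j = inj₂ λ i≢j → contradiction i≡j i≢j
    ... | no  i≢j = [ inj₁ , (λ iso → inj₂ λ _ → iso) ]′ (detour-or-isometric
      (λ v → holds? v ×-dec ¬? ((lookup v i Bool.≟ α) ×-dec (lookup v j Bool.≟ β)))
      (detour⇒three-clauses tc (FE-∧ (FE-rel S idx) (FE-clause₂ tc {s = var i} {var j} i≢j α β))))
  decide : ThreeClauses S ⊎ Isometric Holds → ThreeClauses S ⊎ Iso-avoid →
           ThreeClauses S ⊎ ComponentwiseBijunctive R
  decide (inj₁ th)  _                = inj₁ th
  decide (inj₂ _)   (inj₁ th)        = inj₁ th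
  decide (inj₂ iso) (inj₂ iso-avoid) = inj₂ λ v Rv → majority-closed⇒bijunctive
    -- By `iso` two points are joined by a path exactly when they are joined by a geodesic, and that
    -- is decidable.
    (λ u → map′ geodesic⇒path (path⇒geodesic iso) (geodesic? holds? v u))
    (component-majority-closed iso iso-avoid v) (here Rv)

all-lookup : ∀ {A : Set} {B : A → Set} (xs : List A) → (∀ i → B (L.lookup xs i)) → All B xs
all-lookup []       f = []
all-lookup (x ∷ xs) f = f zero ∷ all-lookup xs (f ∘ suc)

obtains? : ∀ R g → Dec (Obtains R g)
obtains? R g = Fin.any? λ i → Fin.any? λ j → ¬? (i Fin.≟ j) ×-dec anySubset? λ c →
  bool? λ a → bool? λ b → rel R (restrict2 c i j a b) Bool.≟ g a b
  where
  bool? : ∀ {A : Bool → Set} → (∀ b → Dec (A b)) → Dec (∀ b → A b)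
  bool? A? = map′ (λ { (p , q) false → p ; (p , q) true → q }) (λ f → f false , f true)
                  (A? false ×-dec A? true)

FE-obtained : ∀ S (i : Fin (length S)) {g} → Obtains (L.lookup S i) g →
              FE {2} S (λ v → g (lookup v 0F) (lookup v 1F) ≡ true)
FE-obtained S idx {g} (i , j , _ , c , obtained) =
  FE-cong (λ v → mk⇔ (trans (sym (eval v))) (trans (eval v))) (FE-atom S idx ts)
  where
  R = L.lookup S idx
  consts : Vec (Term 2) (arity R)
  consts = V.map const c
  ts : Vec (Term 2) (arity R)
  ts = (consts [ i ]≔ var 0F) [ j ]≔ var 1F
  eval : ∀ v → rel R (evalArgs v ts) ≡ g (lookup v 0F) (lookup v 1F)
  eval v = trans (cong (rel R) (begin
    evalArgs v ts
      ≡⟨ V.map-[]≔ (evalTerm v) (consts [ i ]≔ var 0F) j ⟩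
    evalArgs v (consts [ i ]≔ var 0F) [ j ]≔ lookup v 1F
      ≡⟨ cong (_[ j ]≔ lookup v 1F) (V.map-[]≔ (evalTerm v) consts i) ⟩
    restrict2 (evalArgs v consts) i j (lookup v 0F) (lookup v 1F)
      ≡⟨ cong (λ x → restrict2 x i j (lookup v 0F) (lookup v 1F))
           (trans (sym (V.map-∘ (evalTerm v) const c)) (V.map-id c)) ⟩
    restrict2 c i j (lookup v 0F) (lookup v 1F) ∎)) (obtained _ _)
    where open ≡-Reasoning

-- Obtaining `g` is decidable by finite search, so the negated `All` yields an actual relation of
-- `S`.
obtained-in : ∀ S g → ¬ All (λ R → ¬ Obtains R g) S →
              FE {2} S (λ v → g (lookup v 0F) (lookup v 1F) ≡ true)
obtained-in S g ¬free with Fin.any? (λ i → obtains? (L.lookup S i) g)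
... | yes (i , ob) = FE-obtained S i ob
... | no  ∄        = contradiction (all-lookup S λ i ob → ∄ (i , ob)) ¬free

two-clauses : ∀ S → ¬ Tight S → TwoClauses S
two-clauses S ¬tight = record
  { or   = FE-cong (λ { (false ∷ false ∷ []) → mk⇔ (λ ()) (λ p → contradiction refl p)
                      ; (false ∷ true ∷ [])  → mk⇔ (λ _ ()) (λ _ → refl)
                      ; (true ∷ _ ∷ [])      → mk⇔ (λ _ ()) (λ _ → refl) })
             (obtained-in S _∨_ (¬tight ∘ inj₂ ∘ inj₁))
  ; nand = FE-cong (λ { (false ∷ _ ∷ [])    → mk⇔ (λ _ ()) (λ _ → refl)
                      ; (true ∷ false ∷ []) → mk⇔ (λ _ ()) (λ _ → refl)
                      ; (true ∷ true ∷ [])  → mk⇔ (λ ()) (λ p → contradiction refl p) })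
             (obtained-in S (λ x y → not (x ∧ y)) (¬tight ∘ inj₂ ∘ inj₂))
  }

theorem2p7 : (S : List LogicalRelation) → ¬ Tight S →
    (R : LogicalRelation) → FaithfullyExpressible S R
theorem2p7 S ¬tight R = FE⇒FaithfullyExpressible R (FE-all tc th (rel R))
  where
  tc : TwoClauses S
  tc = two-clauses S ¬tight
  th : ThreeClauses S
  th with ⊎-∀Fin (length S) (λ i → three-clauses-or-componentwise-bijunctive S i tc)
  ... | inj₁ th  = th
  ... | inj₂ cbs = contradiction (inj₁ (all-lookup S cbs)) ¬tight
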